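{- For every $\mathrm{CTL}^*_\pm$ state formula $\varphi$ over a set $AP$ of atomic propositions there is a counter-free visible $\mathrm{HTA}_\pm$ $\mathcal{A}_\varphi$ over $\Sigma=2^{AP}$ such that $\mathcal{L}(\varphi)=\mathcal{L}(\mathcal{A}_\varphi)$.
   Context: Fix a finite set $AP$, $\Sigma=2^{AP}$; $\Sigma$-trees are unranked (finitely many children per node), unordered, leafless trees labelled by $\Sigma$. $\mathrm{CTL}^*_\pm$: state formulae $\varphi ::= p\mid\neg\varphi\mid\varphi\lor\varphi\mid\mathsf{D}^n\varphi\mid\mathsf{E}\psi$, path formulae $\psi ::= \varphi\mid\psi\land\psi\mid\psi\lor\psi\mid\mathsf{X}\psi\mid\psi\,\mathsf{U}\,\psi$. At node $u$: $p$ iff $p\in t(u)$; Booleans usual; $\mathsf{D}^n\varphi$ iff at least $n$ distinct children of $u$ satisfy $\varphi$; $\mathsf{E}\psi$ iff some infinite path $\pi$ from the root has $\pi(i)=u$ and $(t,\pi,i)\models\psi$ (standard semantics for $\mathsf{X},\mathsf{U}$ on infinite paths). $\mathcal{L}(\varphi)$: trees whose root satisfies $\varphi$. $\mathrm{HTA}_\pm$: $\mathcal{A}=\langle Q,\Sigma,\delta,q_I,F\rangle$, $\delta:Q\times\Sigma\to\mathcal{B}^+(\{\Diamond_k,\Box_k\}_{k\in\mathbb{N}}\times Q)$ (positive Boolean formulae over atoms; $\Diamond=\Diamond_1,\Box=\Box_1$). Run on $t$ from $s$: tree $r$ labelled in $Q\times\mathrm{Dom}(t)$, root $(q_I,s)$,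 each node $x$ labelled $(q,v)$ satisfies $\delta(q,t(v))$, where $x\models(\Diamond_k,q')$ iff $x$ has children labelled $(q',v_i)$ for $k$ pairwise distinct children $v_i$ of $v$; $x\models(\Box_k,q')$ iff for all but at most $k-1$ children $v'$ of $v$ some child of $x$ is labelled $(q',v')$. Accepting: every infinite path of $r$ from its root visits $F$ infinitely often. $\mathcal{L}(\mathcal{A})$: trees with an accepting run from the root. $\mathcal{A}^\theta$: $\mathcal{A}$ with fresh initial state $q'$, $\delta(q',\sigma)=\theta$ for all $\sigma$. Hesitant: $Q$ partitioned into totally ordered nonempty components with transitions from $Q_i$ mentioning only states of components $Q_j$, $j\le i$; each component transient (no $Q_i$-atoms in its states' transitions), existential ($Q_i$-atoms only $(\Diamond,q')$, at most one per DNF clause) or universal ($Q_i$-atoms only $(\Box,q')$, at most one per CNF clause). Polarised: existential-component states $\notin F$, universal-component states $\in F$. Linearisation of a non-transient component $Q_i$ at $q\in Q_i$: with $B$ the set of atoms with state outside $Q_i$, $\mathcal{A}^q_{\mathrm{exit}}$ has states $Q_i\cup\{q_{\mathrm{exit}}\}$, alphabet $\Sigma\times2^B$, initial state $q$, and transitions $(q',(\sigma,C),q'')$ where: for existential $Q_i$, $q'=q''=q_{\mathrm{exit}}$, or $q'\in Q_i$, $q''=q_{\mathrm{exit}}$ and the DNF of $\delta(q',\sigma)$ has a clause $\bigwedge C$, or $q',q''\in Q_i$ and the DNF has a clause $(\Diamond,q'')\land\bigwedge C$; for universal $Q_i$ the same with CNF and clauses $\bigvee C$, $(\Box,q'')\lor\bigvee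 C$. A word automaton is counter-free if for every state $p$, finite word $u$, $n>0$, a path on $u^n$ from $p$ to $p$ implies one on $u$ from $p$ to $p$; $\mathcal{A}$ is counter-free if all its linearisations are. $Q_i$ is visible if for each $q\in Q_i$ and all distinct annotations $C\ne C'$ occurring in transitions of $\mathcal{A}^q_{\mathrm{exit}}$ with source in $Q_i$, there exist $\theta\in C$, $\theta'\in C'$ with $\mathcal{L}(\mathcal{A}^\theta)$ and $\mathcal{L}(\mathcal{A}^{\theta'})$ complementary; $\mathcal{A}$ is visible if every non-transient component is visible. -}

module Defs where

open import Level using (0ℓ) renaming (suc to lsuc)
open import Data.Nat using (ℕ; suc; _≤_; _<_)
open import Data.Fin as Fin using (Fin)
open import Data.Fin.Subset as Subset using (Subset)
open import Data.List using (List; []; _∷_; _++_; [_]; map; length; concat; replicate; cartesianProductWith)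
open import Data.List.Membership.Propositional using (_∈_)
open import Data.List.Membership.Propositional.Properties using (∈-map⁺)
open import Data.List.Relation.Unary.Any using (here; there)
open import Data.Maybe using (Maybe; just; nothing)
open import Data.Product using (∃-syntax; Σ-syntax; _×_; _,_; proj₁; proj₂)
open import Data.Sum using (_⊎_)
open import Data.Unit using (⊤)
open import Data.Empty using (⊥)
open import Function.Definitions using (Injective)
open import Relation.Binary.Construct.Closure.ReflexiveTransitive using (Star)
open import Relation.Binary.PropositionalEquality using (_≡_; _≢_; refl)
open import Relation.Nullary using (¬_)
open import Relation.Unary using (Pred; _≐_; ∁; ｛_｝; _∪_)

Finite : Set → Set
Finite A = ∃[ xs ] (∀ (x : A) → x ∈ xs)

AtLeast : {A : Set} → ℕ → Pred A 0ℓ → Set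
AtLeast {A} k P = Σ[ f ∈ (Fin k → A) ] Injective _≡_ _≡_ f × (∀ j → P (f j))

-- All elements of D, with at most k - 1 exceptions, satisfy P.  For k = 0
-- this is false, so that AllBut k D is dual to AtLeast k for every k.
AllBut : {A : Set} → ℕ → (D P : Pred A 0ℓ) → Set
AllBut {A} k D P = Σ[ es ∈ List A ] length es < k × (∀ x → D x → x ∈ es ⊎ P x)

-- Arbitrary unordered rooted trees: leaves and infinite branching are
-- allowed here, since runs may have leaves.
record RootedTree : Set₁ where
  infix 4 _⟶_
  field
    Node          : Set
    root          : Node
    _⟶_           : Node → Node → Set
    root-orphan   : ∀ {u} → ¬ (u ⟶ root)
    parent-unique : ∀ {u u′ v} → u ⟶ v → u′ ⟶ v → u ≡ u′
    reachable     : ∀ v → Star _⟶_ root v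

  record InfinitePath : Set where
    field
      at     : ℕ → Node
      starts : at 0 ≡ root
      step   : ∀ i → at i ⟶ at (suc i)

-- Trees labelled by 2^AP, for AP = Fin n.
record Tree (n : ℕ) : Set₁ where
  field
    shape : RootedTree
  open RootedTree shape public
  field
    label              : Node → Subset n
    finitely-branching : ∀ u → ∃[ vs ] (∀ {v} → u ⟶ v → v ∈ vs)
    leafless           : ∀ u → ∃[ v ] (u ⟶ v)

mutual
  data StateFormula (n : ℕ) : Set where
    prop : Fin n → StateFormula n
    neg  : StateFormula n → StateFormula n
    _or_ : StateFormula n → StateFormula n → StateFormula n
    D    : ℕ → StateFormula n → StateFormula n
    E    : PathFormula n → StateFormula n

  data PathFormula (n : ℕ) : Set where
    state : StateFormula n → PathFormula n
    _and_ : PathFormula n → PathFormula n → PathFormula n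
    _or_  : PathFormula n → PathFormula n → PathFormula n
    X     : PathFormula n → PathFormula n
    _U_   : PathFormula n → PathFormula n → PathFormula n

module _ {n : ℕ} (t : Tree n) where
  open Tree t
  open InfinitePath

  mutual
    Sat : StateFormula n → Node → Set
    Sat (prop p)   u = p Subset.∈ label u
    Sat (neg φ)    u = ¬ Sat φ u
    Sat (φ₁ or φ₂) u = Sat φ₁ u ⊎ Sat φ₂ u
    Sat (D k φ)    u = AtLeast k (λ v → u ⟶ v × Sat φ v)
    Sat (E ψ)      u = Σ[ π ∈ InfinitePath ] Σ[ i ∈ ℕ ] at π i ≡ u × PathSat ψ π i

    PathSat : PathFormula n → InfinitePath → ℕ → Set
    PathSat (state φ)   π i = Sat φ (at π i)
    PathSat (ψ₁ and ψ₂) π i = PathSat ψ₁ π i × PathSat ψ₂ π i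
    PathSat (ψ₁ or ψ₂)  π i = PathSat ψ₁ π i ⊎ PathSat ψ₂ π i
    PathSat (X ψ)       π i = PathSat ψ π (suc i)
    PathSat (ψ₁ U ψ₂)   π i = Σ[ j ∈ ℕ ] i ≤ j × PathSat ψ₂ π j × (∀ k → i ≤ k → k < j → PathSat ψ₁ π k)

ModelsOf : ∀ {n} → StateFormula n → Pred (Tree n) 0ℓ
ModelsOf φ t = Sat t φ (Tree.root t)

data B⁺ (A : Set) : Set where
  true false : B⁺ A
  atom       : A → B⁺ A
  _∧_ _∨_    : B⁺ A → B⁺ A → B⁺ A

module _ {A : Set} where

  ⟦_⟧ : B⁺ A → Pred A 0ℓ → Set
  ⟦ true ⟧   v = ⊤
  ⟦ false ⟧  v = ⊥
  ⟦ atom a ⟧ v = v a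
  ⟦ θ ∧ η ⟧  v = ⟦ θ ⟧ v × ⟦ η ⟧ v
  ⟦ θ ∨ η ⟧  v = ⟦ θ ⟧ v ⊎ ⟦ η ⟧ v

  atoms : B⁺ A → List A
  atoms true     = []
  atoms false    = []
  atoms (atom a) = [ a ]
  atoms (θ ∧ η)  = atoms θ ++ atoms η
  atoms (θ ∨ η)  = atoms θ ++ atoms η

  -- The normal forms are those obtained by distribution.  A clause is a list
  -- of atoms standing for a set: nothing below depends on order or
  -- repetitions.
  dnf cnf : B⁺ A → List (List A)
  dnf true     = [ [] ]
  dnf false    = []
  dnf (atom a) = [ [ a ] ]
  dnf (θ ∧ η)  = cartesianProductWith _++_ (dnf θ) (dnf η)
  dnf (θ ∨ η)  = dnf θ ++ dnf η

  cnf true     = []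
  cnf false    = [ [] ]
  cnf (atom a) = [ [ a ] ]
  cnf (θ ∧ η)  = cnf θ ++ cnf η
  cnf (θ ∨ η)  = cartesianProductWith _++_ (cnf θ) (cnf η)

mapB⁺ : {A B : Set} → (A → B) → B⁺ A → B⁺ B
mapB⁺ f true     = true
mapB⁺ f false    = false
mapB⁺ f (atom a) = atom (f a)
mapB⁺ f (θ ∧ η)  = mapB⁺ f θ ∧ mapB⁺ f η
mapB⁺ f (θ ∨ η)  = mapB⁺ f θ ∨ mapB⁺ f η

data Modality : Set where
  ◇ □ : ℕ → Modality

Atom : Set → Set
Atom Q = Modality × Q

record TreeAutomaton (n : ℕ) : Set₁ where
  field
    Q        : Set
    Q-finite : Finite Q
    δ        : Q → Subset n → B⁺ (Atom Q)
    qI       : Q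
    F        : Pred Q 0ℓ

module _ {n : ℕ} (𝒜 : TreeAutomaton n) (t : Tree n) where
  open TreeAutomaton 𝒜
  private module t = Tree t

  module _ (r : RootedTree) (lab : RootedTree.Node r → Q × t.Node) where
    open RootedTree r

    HasChild : Node → Q → Pred t.Node 0ℓ
    HasChild x q v = ∃[ y ] (x ⟶ y × lab y ≡ (q , v))

    AtomSat : Node → Pred (Atom Q) 0ℓ
    AtomSat x (◇ k , q) = AtLeast k (λ v → proj₂ (lab x) t.⟶ v × HasChild x q v)
    AtomSat x (□ k , q) = AllBut k (proj₂ (lab x) t.⟶_) (HasChild x q)

  record Run (s : t.Node) : Set₁ where
    field
      shape : RootedTree
    open RootedTree shape public
    field
      lab        : Node → Q × t.Node
      root-label : lab root ≡ (qI , s)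
      consistent : ∀ x → ⟦ δ (proj₁ (lab x)) (t.label (proj₂ (lab x))) ⟧ (AtomSat shape lab x)

    Accepting : Set
    Accepting = (π : InfinitePath) → ∀ i → ∃[ j ] (i ≤ j × F (proj₁ (lab (InfinitePath.at π j))))

Language : ∀ {n} → TreeAutomaton n → Pred (Tree n) (lsuc 0ℓ)
Language 𝒜 t = Σ[ r ∈ Run 𝒜 t (Tree.root t) ] Run.Accepting r

-- 𝒜^θ, with `nothing` as the fresh initial state.
module Reinitialised {n : ℕ} (𝒜 : TreeAutomaton n) (θ : B⁺ (Atom (TreeAutomaton.Q 𝒜))) where
  open TreeAutomaton 𝒜

  lift : B⁺ (Atom Q) → B⁺ (Atom (Maybe Q))
  lift = mapB⁺ (λ a → proj₁ a , just (proj₂ a))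

  δ^ : Maybe Q → Subset n → B⁺ (Atom (Maybe Q))
  δ^ nothing  σ = lift θ
  δ^ (just q) σ = lift (δ q σ)

  F^ : Pred (Maybe Q) 0ℓ
  F^ nothing  = ⊥
  F^ (just q) = F q

  finite^ : Finite (Maybe Q)
  finite^ = nothing ∷ map just (proj₁ Q-finite) , λ
    { nothing  → here refl
    ; (just q) → there (∈-map⁺ just (proj₂ Q-finite q)) }

  reinitialised : TreeAutomaton n
  reinitialised = record { Q = Maybe Q ; Q-finite = finite^ ; δ = δ^ ; qI = nothing ; F = F^ }

_^_ : ∀ {n} (𝒜 : TreeAutomaton n) → B⁺ (Atom (TreeAutomaton.Q 𝒜)) → TreeAutomaton n
𝒜 ^ θ = Reinitialised.reinitialised 𝒜 θ

data Polarity : Set where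
  existential universal : Polarity

data Kind : Set where
  transient    : Kind
  nontransient : Polarity → Kind

normalForm : {A : Set} → Polarity → B⁺ A → List (List A)
normalForm existential = dnf
normalForm universal   = cnf

ownModality : Polarity → Modality
ownModality existential = ◇ 1
ownModality universal   = □ 1

record HTA± (n : ℕ) : Set₁ where
  field
    automaton : TreeAutomaton n
  open TreeAutomaton automaton public
  field
    size     : ℕ
    comp     : Q → Fin size
    nonempty : ∀ i → ∃[ q ] (comp q ≡ i)
    kind     : Fin size → Kind

    descending : ∀ q σ m q′ → (m , q′) ∈ atoms (δ q σ) → comp q′ Fin.≤ comp q

    transient-exits : ∀ q σ m q′ → kind (comp q) ≡ transient →
      (m , q′) ∈ atoms (δ q σ) → comp q′ ≢ comp q

    own-modality : ∀ q σ m q′ p → kind (comp q) ≡ nontransient p →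
      (m , q′) ∈ atoms (δ q σ) → comp q′ ≡ comp q → m ≡ ownModality p

    at-most-one : ∀ q σ p → kind (comp q) ≡ nontransient p →
      ∀ clause → clause ∈ normalForm p (δ q σ) →
      ∀ a b → a ∈ clause → b ∈ clause →
      comp (proj₂ a) ≡ comp q → comp (proj₂ b) ≡ comp q → a ≡ b

    existential-rejecting : ∀ q → kind (comp q) ≡ nontransient existential → ¬ F q
    universal-accepting   : ∀ q → kind (comp q) ≡ nontransient universal → F q

record WordAutomaton : Set₂ where
  field
    State      : Set
    Letter     : Set₁
    initial    : State
    Transition : State → Letter → State → Set

  data Path : State → List Letter → State → Set₁ where
    []  : ∀ {p} → Path p [] p
    _∷_ : ∀ {p a p′ w p″} → Transition p a p′ → Path p′ w p″ → Path p (a ∷ w) p″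

CounterFreeWA : WordAutomaton → Set₁
CounterFreeWA W = ∀ p u k → 0 < k → Path p (concat (replicate k u)) p → Path p u p
  where open WordAutomaton W

module _ {n : ℕ} (𝒜 : HTA± n) where
  open HTA± 𝒜

  Component : Fin size → Set
  Component i = ∃[ q ] (comp q ≡ i)

  OutsideAtom : Fin size → Set
  OutsideAtom i = Σ[ a ∈ Atom Q ] comp (proj₂ a) ≢ i

  Annotation : Fin size → Set₁
  Annotation i = Pred (OutsideAtom i) 0ℓ

  asAtoms : ∀ {i} → Annotation i → Pred (Atom Q) 0ℓ
  asAtoms {i} C a = Σ[ out ∈ comp (proj₂ a) ≢ i ] C (a , out)

  -- `nothing` is the exit state.
  LinTransition : (i : Fin size) → Polarity →
    Maybe (Component i) → Subset n × Annotation i → Maybe (Component i) → Set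
  LinTransition i p nothing         a       nothing         = ⊤
  LinTransition i p nothing         a       (just _)        = ⊥
  LinTransition i p (just (q′ , _)) (σ , C) nothing         =
    ∃[ clause ] (clause ∈ normalForm p (δ q′ σ) × (_∈ clause) ≐ asAtoms C)
  LinTransition i p (just (q′ , _)) (σ , C) (just (q″ , _)) =
    ∃[ clause ] (clause ∈ normalForm p (δ q′ σ) × (_∈ clause) ≐ (｛ (ownModality p , q″) ｝ ∪ asAtoms C))

  linearisation : (i : Fin size) → Polarity → Component i → WordAutomaton
  linearisation i p q = record
    { State      = Maybe (Component i)
    ; Letter     = Subset n × Annotation i
    ; initial    = just q
    ; Transition = LinTransition i p
    }

  CounterFree : Set₁
  CounterFree = ∀ i p → kind i ≡ nontransient p → ∀ q → CounterFreeWA (linearisation i p q)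

  OccursIn : ∀ {i} (p : Polarity) (q : Component i) → Annotation i → Set
  OccursIn {i} p q C = ∃[ q′ ] ∃[ σ ] ∃[ s ] Transition (just q′) (σ , C) s
    where open WordAutomaton (linearisation i p q)

  Complementary : (θ θ′ : Atom Q) → Set₁
  Complementary θ θ′ = Language (automaton ^ atom θ) ≐ ∁ (Language (automaton ^ atom θ′))

  VisibleComponent : Fin size → Polarity → Set₁
  VisibleComponent i p = ∀ (q : Component i) (C C′ : Annotation i) →
    OccursIn p q C → OccursIn p q C′ → ¬ (C ≐ C′) →
    ∃[ θ ] ∃[ θ′ ] (C θ × C′ θ′ × Complementary (proj₁ θ) (proj₁ θ′))

  Visible : Set₁
  Visible = ∀ i p → kind i ≡ nontransient p → VisibleComponent i p

{-# OPTIONS --safe #-}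
module Submission where

open import Defs
open import Level using (0ℓ; Lift; lift) renaming (suc to lsuc)
open import Data.Nat as ℕ using (ℕ; zero; suc; _≤_; _<_)
import Data.Nat.Properties as ℕ
open import Data.Nat.Induction using (<-wellFounded)
open import Data.Fin as Fin using (Fin; zero; suc)
import Data.Fin.Properties as Fin
open import Data.Fin.Relation.Unary.Top using (view; ‵fromℕ; ‵inject₁; view-fromℕ; view-inject₁)
open import Data.Fin.Subset as Subset using (Subset)
import Data.Fin.Subset.Properties as Subset
open import Data.Bool as Bool using (Bool)
import Data.Bool.Properties as Bool
open import Data.Vec using ([]; _∷_)
open import Data.List using (List; []; _∷_; _++_; [_]; map; length; lookup; foldr; filter; concat; concatMap; replicate; allFin; cartesianProduct; cartesianProductWith)
open import Data.List.Properties using (map-id; map-++; map-∘; map-cong; map-replicate; concat-map; foldr-++)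
open import Data.List.Membership.Propositional using (_∈_; lose; find)
open import Data.List.Membership.Propositional.Properties using (∈-++⁻; ∈-++⁺ˡ; ∈-++⁺ʳ; ∈-lookup; ∈-map⁺; ∈-map⁻; ∈-allFin; ∈-concatMap⁺; ∈-concatMap⁻; ∈-cartesianProduct⁺; ∈-cartesianProduct⁻; ∈-cartesianProductWith⁺; ∈-filter⁺; ∈-filter⁻)
import Data.List.Relation.Binary.Subset.Propositional as List
open import Data.List.Relation.Unary.Any using (here; there; index)
open import Data.List.Relation.Unary.Any.Properties using (lookup-index)
open import Data.List.Relation.Unary.All as All using (All; []; _∷_)
open import Data.List.Relation.Unary.All.Properties using (¬Any⇒All¬)
open import Data.List.Relation.Unary.Unique.Propositional using (Unique; []; _∷_)
open import Data.Maybe as Maybe using (Maybe; just; nothing; maybe)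
open import Data.Maybe.Properties using (just-injective)
open import Data.Product as Product using (∃-syntax; Σ-syntax; _×_; _,_; proj₁; proj₂)
open import Data.Sum as Sum using (_⊎_; inj₁; inj₂)
open import Data.Unit using (⊤; tt)
open import Data.Empty using (⊥; ⊥-elim)
open import Function using (_∘_; id; mk⇔)
open import Induction.WellFounded using (Acc; acc)
open import Axiom.ExcludedMiddle using (ExcludedMiddle)
open import Relation.Binary.Construct.Closure.ReflexiveTransitive using (Star; ε; _◅_; _◅◅_)
open import Relation.Binary.PropositionalEquality using (_≡_; _≢_; refl; sym; trans; cong; cong₂; subst; module ≡-Reasoning)
open import Relation.Nullary using (¬_; Dec; yes; no; does)
import Relation.Nullary.Decidable as Dec
open import Relation.Unary using (Pred; _≐_; _⊆_; ∁)

-- States come in dual pairs: a state and the state for the complementary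
-- property, whose transition formula is the De Morgan dual.  The path formulae
-- have no negation, so E ψ holds iff some finite path witnesses ψ.  An
-- existential component for E ψ guesses such a path together with the truth
-- values of all path subformulae of ψ on the rest of it.  These are determined
-- by the current letter and the truth values one step later, so the
-- linearisation is reverse deterministic; it is counter-free because around a
-- cycle the bit of each until formula is updated by a monotone map of {0,1}.
-- State subformulae are read off from an annotation that contains every
-- relevant atom or its dual, which makes the component visible.  Correctness
-- is a ranked strategy argument: a winning strategy unravels to an accepting
-- run, and a strategy for the dual state exposes a rejecting branch of any run.

-- Finite witnesses agree with polarisation. Existential states lie outside `F`, so an accepting run
-- has to leave their component; the exit is the end of the guessed prefix, beyond which every path
-- subformula counts as false (`empty`). The rank of a tracking state is the number of edges of the
-- prefix still to be read. Dual tracking states lie in `F`: for them, staying for ever is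
-- acceptance.
--
-- Exact truth values are guessed instead of obligations because obligations would leave the
-- predecessor open, whereas an exact valuation is a function of letter and successor.
-- Counter-freeness then becomes aperiodicity of a composed function. The price is that an
-- annotation has to refute false atoms as well as confirm true ones, so both halves of every dual
-- pair have to be correct together.
--
-- Runs are kept out of the induction on formulae. `translate` is shown correct against the semantic
-- truth of the atoms at a node (`True`); only then does the game turn these one-step facts into
-- accepting runs or rejecting branches.

-- Positive Boolean formulae: normal forms and De Morgan duality.

module _ {A : Set} where

  ⟦⟧-mono : ∀ (θ : B⁺ A) {V W : Pred A 0ℓ} → (∀ a → a ∈ atoms θ → V a → W a) → ⟦ θ ⟧ V → ⟦ θ ⟧ W
  ⟦⟧-mono true     f _        = tt
  ⟦⟧-mono (atom a) f v        = f a (here refl) v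
  ⟦⟧-mono (θ ∧ η)  f (x , y)  =
    ⟦⟧-mono θ (λ a → f a ∘ ∈-++⁺ˡ) x , ⟦⟧-mono η (λ a → f a ∘ ∈-++⁺ʳ (atoms θ)) y
  ⟦⟧-mono (θ ∨ η)  f (inj₁ x) = inj₁ (⟦⟧-mono θ (λ a → f a ∘ ∈-++⁺ˡ) x)
  ⟦⟧-mono (θ ∨ η)  f (inj₂ y) = inj₂ (⟦⟧-mono η (λ a → f a ∘ ∈-++⁺ʳ (atoms θ)) y)

  conj : List A → B⁺ A
  conj []       = true
  conj (a ∷ as) = atom a ∧ conj as

  disj : List (List A) → B⁺ A
  disj []       = false
  disj (c ∷ cs) = conj c ∨ disj cs

  dnf-conj : ∀ c → dnf (conj c) ≡ [ c ]
  dnf-conj []      = refl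
  dnf-conj (a ∷ c) rewrite dnf-conj c = refl

  -- An equality of lists, not an equivalence: distribution returns exactly the clauses put in, so
  -- the transitions of a linearisation can be read off from `clauses`.
  dnf-disj : ∀ cs → dnf (disj cs) ≡ cs
  dnf-disj []       = refl
  dnf-disj (c ∷ cs) rewrite dnf-conj c = cong (c ∷_) (dnf-disj cs)

  ⟦conj⟧⁺ : ∀ {V : Pred A 0ℓ} c → (∀ a → a ∈ c → V a) → ⟦ conj c ⟧ V
  ⟦conj⟧⁺ []      f = tt
  ⟦conj⟧⁺ (a ∷ c) f = f a (here refl) , ⟦conj⟧⁺ c (λ b → f b ∘ there)

  ⟦conj⟧⁻ : ∀ {V : Pred A 0ℓ} c → ⟦ conj c ⟧ V → ∀ a → a ∈ c → V a
  ⟦conj⟧⁻ (a ∷ c) (x , y) _ (here refl) = x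
  ⟦conj⟧⁻ (a ∷ c) (x , y) b (there b∈c) = ⟦conj⟧⁻ c y b b∈c

  ⟦disj⟧⁺ : ∀ {V : Pred A 0ℓ} {cs c} → c ∈ cs → (∀ a → a ∈ c → V a) → ⟦ disj cs ⟧ V
  ⟦disj⟧⁺ (here refl) f = inj₁ (⟦conj⟧⁺ _ f)
  ⟦disj⟧⁺ (there c∈)  f = inj₂ (⟦disj⟧⁺ c∈ f)

  ⟦disj⟧⁻ : ∀ {V : Pred A 0ℓ} cs → ⟦ disj cs ⟧ V → ∃[ c ] (c ∈ cs × (∀ a → a ∈ c → V a))
  ⟦disj⟧⁻ (c ∷ cs) (inj₁ x) = c , here refl , ⟦conj⟧⁻ c x
  ⟦disj⟧⁻ (c ∷ cs) (inj₂ y) with c′ , c′∈ , f ← ⟦disj⟧⁻ cs y = c′ , there c′∈ , f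

  atoms-conj : ∀ c → atoms (conj c) ≡ c
  atoms-conj []      = refl
  atoms-conj (a ∷ c) = cong (a ∷_) (atoms-conj c)

  atoms-disj⁻ : ∀ cs {a} → a ∈ atoms (disj cs) → ∃[ c ] (c ∈ cs × a ∈ c)
  atoms-disj⁻ (c ∷ cs) a∈ rewrite atoms-conj c with ∈-++⁻ c a∈
  ... | inj₁ x = c , here refl , x
  ... | inj₂ y with c′ , c′∈ , x ← atoms-disj⁻ cs y = c′ , there c′∈ , x

  module _ (f : A → A) where

    dualise : B⁺ A → B⁺ A
    dualise true     = false
    dualise false    = true
    dualise (atom a) = atom (f a)
    dualise (θ ∧ η)  = dualise θ ∨ dualise η
    dualise (θ ∨ η)  = dualise θ ∧ dualise η

    atoms-dualise : ∀ θ → atoms (dualise θ) ≡ map f (atoms θ)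
    atoms-dualise true     = refl
    atoms-dualise false    = refl
    atoms-dualise (atom a) = refl
    atoms-dualise (θ ∧ η)  =
      trans (cong₂ _++_ (atoms-dualise θ) (atoms-dualise η)) (sym (map-++ f (atoms θ) (atoms η)))
    atoms-dualise (θ ∨ η)  =
      trans (cong₂ _++_ (atoms-dualise θ) (atoms-dualise η)) (sym (map-++ f (atoms θ) (atoms η)))

    map-product : ∀ (cs ds : List (List A)) →
      cartesianProductWith _++_ (map (map f) cs) (map (map f) ds) ≡ map (map f) (cartesianProductWith _++_ cs ds)
    map-product []       ds = refl
    map-product (c ∷ cs) ds = begin
      map (map f c ++_) (map (map f) ds) ++ cartesianProductWith _++_ (map (map f) cs) (map (map f) ds)
        ≡⟨ cong₂ _++_ (trans (sym (map-∘ ds)) (trans (map-cong (sym ∘ map-++ f c) ds) (map-∘ ds))) (map-product cs ds) ⟩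
      map (map f) (map (c ++_) ds) ++ map (map f) (cartesianProductWith _++_ cs ds)
        ≡⟨ map-++ (map f) (map (c ++_) ds) _ ⟨
      map (map f) (map (c ++_) ds ++ cartesianProductWith _++_ cs ds) ∎
      where open ≡-Reasoning

    cnf-dualise : ∀ θ → cnf (dualise θ) ≡ map (map f) (dnf θ)
    cnf-dualise true     = refl
    cnf-dualise false    = refl
    cnf-dualise (atom a) = refl
    cnf-dualise (θ ∧ η)  =
      trans (cong₂ (cartesianProductWith _++_) (cnf-dualise θ) (cnf-dualise η)) (map-product (dnf θ) (dnf η))
    cnf-dualise (θ ∨ η)  =
      trans (cong₂ _++_ (cnf-dualise θ) (cnf-dualise η)) (sym (map-++ (map f) (dnf θ) (dnf η)))

    -- A formula and its dual are one game seen by opposite players; following both winning choices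
    -- leads to a single atom that each of them claims.
    dualise-disjoint : ∀ {V W : Pred A 0ℓ} θ → ⟦ θ ⟧ V → ⟦ dualise θ ⟧ W → ∃[ a ] (V a × W (f a))
    dualise-disjoint (atom a) x        y        = a , x , y
    dualise-disjoint (θ ∧ η)  (x , _)  (inj₁ y) = dualise-disjoint θ x y
    dualise-disjoint (θ ∧ η)  (_ , x)  (inj₂ y) = dualise-disjoint η x y
    dualise-disjoint (θ ∨ η)  (inj₁ x) (y , _)  = dualise-disjoint θ x y
    dualise-disjoint (θ ∨ η)  (inj₂ x) (_ , y)  = dualise-disjoint η x y

    dualise-exhaustive : ∀ {V W : Pred A 0ℓ} → (∀ a → V a ⊎ W (f a)) → ∀ θ → ⟦ θ ⟧ V ⊎ ⟦ dualise θ ⟧ W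
    dualise-exhaustive h true     = inj₁ tt
    dualise-exhaustive h false    = inj₂ tt
    dualise-exhaustive h (atom a) = h a
    dualise-exhaustive h (θ ∧ η)  with dualise-exhaustive h θ | dualise-exhaustive h η
    ... | inj₁ x | inj₁ y = inj₁ (x , y)
    ... | inj₂ x | _      = inj₂ (inj₁ x)
    ... | inj₁ _ | inj₂ y = inj₂ (inj₂ y)
    dualise-exhaustive h (θ ∨ η)  with dualise-exhaustive h θ | dualise-exhaustive h η
    ... | inj₁ x | _      = inj₁ (inj₁ x)
    ... | inj₂ _ | inj₁ y = inj₁ (inj₂ y)
    ... | inj₂ x | inj₂ y = inj₂ (x , y)

    dualise-involutive : (∀ a → f (f a) ≡ a) → ∀ θ → dualise (dualise θ) ≡ θ
    dualise-involutive inv true     = refl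
    dualise-involutive inv false    = refl
    dualise-involutive inv (atom a) = cong atom (inv a)
    dualise-involutive inv (θ ∧ η)  = cong₂ _∧_ (dualise-involutive inv θ) (dualise-involutive inv η)
    dualise-involutive inv (θ ∨ η)  = cong₂ _∨_ (dualise-involutive inv θ) (dualise-involutive inv η)

⟦mapB⁺⟧⁺ : ∀ {A B : Set} (f : A → B) {V : Pred B 0ℓ} θ → ⟦ θ ⟧ (V ∘ f) → ⟦ mapB⁺ f θ ⟧ V
⟦mapB⁺⟧⁺ f true     x        = tt
⟦mapB⁺⟧⁺ f (atom a) x        = x
⟦mapB⁺⟧⁺ f (θ ∧ η)  (x , y)  = ⟦mapB⁺⟧⁺ f θ x , ⟦mapB⁺⟧⁺ f η y
⟦mapB⁺⟧⁺ f (θ ∨ η)  (inj₁ x) = inj₁ (⟦mapB⁺⟧⁺ f θ x)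
⟦mapB⁺⟧⁺ f (θ ∨ η)  (inj₂ y) = inj₂ (⟦mapB⁺⟧⁺ f η y)

⟦mapB⁺⟧⁻ : ∀ {A B : Set} (f : A → B) {V : Pred B 0ℓ} θ → ⟦ mapB⁺ f θ ⟧ V → ⟦ θ ⟧ (V ∘ f)
⟦mapB⁺⟧⁻ f true     x        = tt
⟦mapB⁺⟧⁻ f (atom a) x        = x
⟦mapB⁺⟧⁻ f (θ ∧ η)  (x , y)  = ⟦mapB⁺⟧⁻ f θ x , ⟦mapB⁺⟧⁻ f η y
⟦mapB⁺⟧⁻ f (θ ∨ η)  (inj₁ x) = inj₁ (⟦mapB⁺⟧⁻ f θ x)
⟦mapB⁺⟧⁻ f (θ ∨ η)  (inj₂ y) = inj₂ (⟦mapB⁺⟧⁻ f η y)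

-- Duality of the counting quantifiers.

module _ {A : Set} where

  AllBut-mono : ∀ {k} {B P R : Pred A 0ℓ} → (∀ {x} → B x → P x → R x) → AllBut k B P → AllBut k B R
  AllBut-mono h (es , l , g) = es , l , λ x d → Sum.map₂ (h d) (g x d)

  all-or-some : ∀ k {P R : Fin k → Set} → (∀ j → P j ⊎ R j) → (∀ j → P j) ⊎ ∃[ j ] R j
  all-or-some zero    h = inj₁ λ ()
  all-or-some (suc k) h with h zero | all-or-some k (h ∘ suc)
  ... | inj₂ r | _            = inj₂ (zero , r)
  ... | inj₁ p | inj₂ (j , r) = inj₂ (suc j , r)
  ... | inj₁ p | inj₁ ps      = inj₁ λ { zero → p ; (suc j) → ps j }

  -- Pigeonhole: k distinct elements do not fit among fewer than k exceptions.
  AtLeast-meets-AllBut : ∀ {k} {B P R : Pred A 0ℓ} →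
    AtLeast k (λ x → B x × P x) → AllBut k B R → ∃[ x ] (B x × P x × R x)
  AtLeast-meets-AllBut {k} (f , f-inj , dp) (es , es<k , g)
    with all-or-some k (λ j → g (f j) (proj₁ (dp j)))
  ... | inj₂ (j , r) = f j , proj₁ (dp j) , proj₂ (dp j) , r
  ... | inj₁ f∈es with i , j , i<j , eq ← Fin.pigeonhole es<k (index ∘ f∈es) =
    ⊥-elim (Fin.<⇒≢ i<j (f-inj (trans (lookup-index (f∈es i)) (trans (cong (lookup es) eq) (sym (lookup-index (f∈es j)))))))

  lookup-injective : ∀ {es : List A} → Unique es → ∀ {i j} → lookup es i ≡ lookup es j → i ≡ j
  lookup-injective (_  ∷ _)  {zero}  {zero}  _  = refl
  lookup-injective (x≢ ∷ _)  {zero}  {suc j} eq = ⊥-elim (All.lookup x≢ (∈-lookup j) eq)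
  lookup-injective (x≢ ∷ _)  {suc i} {zero}  eq = ⊥-elim (All.lookup x≢ (∈-lookup i) (sym eq))
  lookup-injective (_  ∷ un) {suc i} {suc j} eq = cong suc (lookup-injective un eq)

module Classical (em : ExcludedMiddle (lsuc 0ℓ)) where

  lem : (P : Set) → Dec P
  lem P = Dec.map′ Lift.lower lift (em {Lift (lsuc 0ℓ) P})

  by-contradiction : ∀ {P : Set} → ¬ ¬ P → P
  by-contradiction {P} = Dec.decidable-stable (lem P)

  -- A repetition-free list of all solutions settles both quantifiers: if long enough, its entries
  -- witness `AtLeast`; otherwise it is itself the list of exceptions for `AllBut`.
  distinct-witnesses : ∀ {A : Set} (P : Pred A 0ℓ) xs →
    ∃[ es ] (Unique es × All P es × (∀ {x} → x ∈ xs → P x → x ∈ es))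
  distinct-witnesses P [] = [] , [] , [] , λ ()
  distinct-witnesses P (x ∷ xs) with distinct-witnesses P xs | lem (P x)
  ... | es , un , ps , cover | no ¬p =
    es , un , ps , λ { (here refl) p → ⊥-elim (¬p p) ; (there y∈) → cover y∈ }
  ... | es , un , ps , cover | yes p with lem (x ∈ es)
  ...   | yes x∈ = es , un , ps , λ { (here refl) _ → x∈ ; (there y∈) → cover y∈ }
  ...   | no x∉  = x ∷ es , ¬Any⇒All¬ es x∉ ∷ un , p ∷ ps ,
                   λ { (here refl) _ → here refl ; (there y∈) → there ∘ cover y∈ }

  AtLeast-or-AllBut : ∀ {A : Set} {B : Pred A 0ℓ} {xs} → (∀ {x} → B x → x ∈ xs) → ∀ k (P : Pred A 0ℓ) →
    AtLeast k (λ x → B x × P x) ⊎ AllBut k B (¬_ ∘ P)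
  AtLeast-or-AllBut {B = B} {xs} fin k P with distinct-witnesses (λ x → B x × P x) xs
  ... | es , un , ps , cover with k ℕ.≤? length es
  ...   | yes k≤ = inj₁ ((λ j → lookup es (Fin.inject≤ j k≤))
                        , (λ eq → Fin.inject≤-injective k≤ k≤ _ _ (lookup-injective un eq))
                        , λ j → All.lookup ps (∈-lookup (Fin.inject≤ j k≤)))
  ...   | no k≰  = inj₂ (es , ℕ.≰⇒> k≰ , exceptions)
    where
    exceptions : ∀ x → B x → x ∈ es ⊎ ¬ P x
    exceptions x d with lem (P x)
    ... | yes p = inj₁ (cover (fin d) (d , p))
    ... | no ¬p = inj₂ ¬p

-- Ranked strategies, accepting runs and rejecting branches.

flip : Modality → Modality
flip (◇ k) = □ k
flip (□ k) = ◇ k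

-- Keys name the components and G is the set that a play has to visit
-- infinitely often: ranks (d, d′) decrease as long as the play stays in a
-- component without visiting G.
module Ranking {Q K : Set} (key : Q → K) (height : K → ℕ) (G : Pred Q 0ℓ) where

  Progress : Q → ℕ → Q → ℕ → Set
  Progress q d q′ d′ = height (key q′) < height (key q) ⊎ key q′ ≡ key q × (G q ⊎ d′ < d)

  infix 4 _⊑_
  _⊑_ : Q → Q → Set
  q′ ⊑ q = height (key q′) < height (key q) ⊎ key q′ ≡ key q

  ⊑-trans : ∀ {q q′ q″} → q″ ⊑ q′ → q′ ⊑ q → q″ ⊑ q
  ⊑-trans (inj₁ x) (inj₁ y) = inj₁ (ℕ.<-trans x y)
  ⊑-trans {q″ = q″} (inj₁ x) (inj₂ y) = inj₁ (subst (λ c → height (key q″) < height c) y x)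
  ⊑-trans {q = q} (inj₂ x) (inj₁ y) = inj₁ (subst (λ c → height c < height (key q)) (sym x) y)
  ⊑-trans (inj₂ x) (inj₂ y) = inj₂ (trans x y)

  module Play (q : ℕ → Q) (d : ℕ → ℕ) (prog : ∀ i → Progress (q i) (d i) (q (suc i)) (d (suc i))) where

    step-⊑ : ∀ i → q (suc i) ⊑ q i
    step-⊑ i with prog i
    ... | inj₁ x       = inj₁ x
    ... | inj₂ (x , _) = inj₂ x

    descends : ∀ {i j} → i ℕ.≤′ j → q j ⊑ q i
    descends ℕ.≤′-refl       = inj₂ refl
    descends (ℕ.≤′-step i≤j) = ⊑-trans (step-⊑ _) (descends i≤j)

    -- Lexicographic descent: a change of component lowers the height and may reset the rank to
    -- anything; inside a component the rank falls until `G` is met.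
    visits : ∀ i → ∃[ j ] (i ≤ j × G (q j))
    visits i = outer i refl (<-wellFounded _)
      where
      outer : ∀ i {h} → height (key (q i)) ≡ h → Acc _<_ h → ∃[ j ] (i ≤ j × G (q j))
      outer i {h} eq (acc rs) = inner i eq (<-wellFounded (d i))
        where
        inner : ∀ i → height (key (q i)) ≡ h → Acc _<_ (d i) → ∃[ j ] (i ≤ j × G (q j))
        inner i refl (acc rsᵈ) with prog i
        ... | inj₁ lower = Product.map₂ (Product.map₁ ℕ.<⇒≤) (outer (suc i) refl (rs lower))
        ... | inj₂ (_ , inj₁ g) = i , ℕ.≤-refl , g
        ... | inj₂ (same , inj₂ d<) =
          Product.map₂ (Product.map₁ ℕ.<⇒≤) (inner (suc i) (cong height same) (rsᵈ d<))

module AtomSemantics {n : ℕ} (t : Tree n) where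
  open Tree t

  -- `H` may stand for the children of a run node, for semantic truth or for winning positions, so
  -- that the three can be played against each other.
  AtomHolds : {Q : Set} → (Q → Pred Node 0ℓ) → Node → Pred (Atom Q) 0ℓ
  AtomHolds H u (◇ k , q) = AtLeast k (λ v → u ⟶ v × H q v)
  AtomHolds H u (□ k , q) = AllBut k (u ⟶_) (H q)

  AtomHolds-map : ∀ {Q Q′ : Set} {H : Q → Pred Node 0ℓ} {H′ : Q′ → Pred Node 0ℓ} {u} m {q q′} →
    (∀ {v} → u ⟶ v → H q v → H′ q′ v) → AtomHolds H u (m , q) → AtomHolds H′ u (m , q′)
  AtomHolds-map (◇ k) h (f , f-inj , x) = f , f-inj , λ j → proj₁ (x j) , h (proj₁ (x j)) (proj₂ (x j))
  AtomHolds-map (□ k) h = AllBut-mono h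

  AtomHolds-meet : ∀ {Q Q′ : Set} {H : Q → Pred Node 0ℓ} {H′ : Q′ → Pred Node 0ℓ} {u} m {q q′} →
    AtomHolds H u (m , q) → AtomHolds H′ u (flip m , q′) → ∃[ v ] (u ⟶ v × H q v × H′ q′ v)
  AtomHolds-meet (◇ k) x y = AtLeast-meets-AllBut x y
  AtomHolds-meet (□ k) x y with v , e , h′ , h ← AtLeast-meets-AllBut y x = v , e , h , h′

-- W q u d: the player wins from state q at node u with rank d.  The player is
-- the one building a run in Unravel (where G is F), its opponent in Refute.
module Game {n : ℕ} (𝒜 : TreeAutomaton n) (t : Tree n)
            {K : Set} (key : TreeAutomaton.Q 𝒜 → K) (height : K → ℕ)
            (G : Pred (TreeAutomaton.Q 𝒜) 0ℓ)
            (W : TreeAutomaton.Q 𝒜 → Tree.Node t → ℕ → Set) where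
  open TreeAutomaton 𝒜
  open Ranking key height G
  open AtomSemantics t
  private module t = Tree t

  WinsFrom : Q → ℕ → Q → Pred t.Node 0ℓ
  WinsFrom q d q′ v = ∃[ d′ ] (W q′ v d′ × Progress q d q′ d′)

  module Unravel (G⊆F : ∀ {q} → G q → F q)
                 (move : ∀ q u d → W q u d → ⟦ δ q (t.label u) ⟧ (AtomHolds (WinsFrom q d) u))
                 (s : t.Node) (d₀ : ℕ) (w₀ : W qI s d₀) where

    -- Nodes of the run are whole histories, which makes parents unique. Every winning move becomes
    -- a child, so no strategy has to be selected: atoms are monotone in the children, and progress
    -- holds along each edge.
    data History : Q → t.Node → ℕ → Set where
      start : History qI s d₀
      _▷_   : ∀ {q u d q′ u′ d′} → History q u d → u t.⟶ u′ × W q′ u′ d′ × Progress q d q′ d′ → History q′ u′ d′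

    RunNode : Set
    RunNode = ∃[ q ] ∃[ u ] ∃[ d ] History q u d

    data Edge : RunNode → RunNode → Set where
      edge : ∀ {q u d q′ u′ d′} (h : History q u d) (m : u t.⟶ u′ × W q′ u′ d′ × Progress q d q′ d′) →
             Edge (q , u , d , h) (q′ , u′ , d′ , h ▷ m)

    reach : ∀ {q u d} (h : History q u d) → Star Edge (qI , s , d₀ , start) (q , u , d , h)
    reach start   = ε
    reach (h ▷ m) = reach h ◅◅ (edge h m ◅ ε)

    unique-parent : ∀ {x x′ y} → Edge x y → Edge x′ y → x ≡ x′
    unique-parent (edge h m) (edge .h .m) = refl

    unravelling : RootedTree
    unravelling = record
      { Node = RunNode ; root = qI , s , d₀ , start ; _⟶_ = Edge ; root-orphan = λ ()
      ; parent-unique = unique-parent ; reachable = λ (_ , _ , _ , h) → reach h }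

    lab : RunNode → Q × t.Node
    lab (q , u , _) = q , u

    wins : ∀ {q u d} → History q u d → W q u d
    wins start             = w₀
    wins (_ ▷ (_ , w , _)) = w

    atom-sat : ∀ {q u d} (h : History q u d) a → AtomHolds (WinsFrom q d) u a →
      AtomSat 𝒜 t unravelling lab (q , u , d , h) a
    atom-sat h (◇ k , q′) (f , f-inj , x) =
      f , f-inj , λ j → let e , d′ , w , p = x j in e , _ , edge h (e , w , p) , refl
    atom-sat h (□ k , q′) = AllBut-mono λ { e (d′ , w , p) → _ , edge h (e , w , p) , refl }

    run : Run 𝒜 t s
    run = record
      { shape = unravelling ; lab = lab ; root-label = refl
      ; consistent = λ (q , u , d , h) → ⟦⟧-mono (δ q (t.label u)) (λ a _ → atom-sat h a) (move q u d (wins h)) }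

    edge-progress : ∀ {x y : RunNode} → Edge x y →
      Progress (proj₁ x) (proj₁ (proj₂ (proj₂ x))) (proj₁ y) (proj₁ (proj₂ (proj₂ y)))
    edge-progress (edge h (_ , _ , p)) = p

    accepting : Run.Accepting run
    accepting π i = Product.map₂ (Product.map₂ G⊆F)
      (Play.visits (λ i → proj₁ (at i)) (λ i → proj₁ (proj₂ (proj₂ (at i)))) (λ i → edge-progress (step i)) i)
      where open RootedTree.InfinitePath π

  module Refute (F-G-apart : ∀ {q q′} → F q → G q′ → key q ≢ key q′)
                (refute : ∀ q u d → W q u d → ∀ (V : Pred (Atom Q) 0ℓ) → ⟦ δ q (t.label u) ⟧ V →
                          ∃[ m ] ∃[ q′ ] (V (m , q′) × AtomHolds (WinsFrom q d) u (flip m , q′)))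
                {s : t.Node} {d₀ : ℕ} (w₀ : W qI s d₀) (r : Run 𝒜 t s) where
    open Run r

    atom-holds : ∀ x a → AtomSat 𝒜 t shape lab x a → AtomHolds (HasChild 𝒜 t shape lab x) (proj₂ (lab x)) a
    atom-holds x (◇ k , q) y = y
    atom-holds x (□ k , q) y = y

    Refuted : Set
    Refuted = Σ[ x ∈ Node ] Σ[ d ∈ ℕ ] W (proj₁ (lab x)) (proj₂ (lab x)) d

    state-of : Refuted → Q
    state-of (x , _) = proj₁ (lab x)

    rank-of : Refuted → ℕ
    rank-of (_ , d , _) = d

    -- An atom that the run satisfies and the opponent's claim for the flipped atom meet at one
    -- child of the tree node; the run has a child there, and the opponent still wins at it.
    descend : ∀ (x : Refuted) →
      Σ[ y ∈ Refuted ] (proj₁ x ⟶ proj₁ y × Progress (state-of x) (rank-of x) (state-of y) (rank-of y))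
    descend (x , d , w) with refute _ _ d w (AtomSat 𝒜 t shape lab x) (consistent x)
    ... | m , q′ , sat , good with AtomHolds-meet m (atom-holds x (m , q′) sat) good
    ... | v , _ , (y , x⟶y , eq) , (d′ , w′ , p) =
      (y , d′ , subst (λ (q , u) → W q u d′) (sym eq) w′) , x⟶y
      , subst (λ q → Progress (proj₁ (lab x)) d q d′) (cong proj₁ (sym eq)) p

    origin : Refuted
    origin = root , d₀ , subst (λ (q , u) → W q u d₀) (sym root-label) w₀

    branch : ℕ → Refuted
    branch zero    = origin
    branch (suc i) = proj₁ (descend (branch i))

    path : InfinitePath
    path = record { at = proj₁ ∘ branch ; starts = refl ; step = λ i → proj₁ (proj₂ (descend (branch i))) }

    open Play (state-of ∘ branch) (rank-of ∘ branch) (λ i → proj₂ (proj₂ (descend (branch i))))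

    -- Acceptance gives `F` infinitely often, the ranks give `G` infinitely often. The two never
    -- share a component, so from a visit to `F` to a later visit to `G` the height drops, and this
    -- cannot recur for ever.
    rejecting : ¬ Accepting
    rejecting acc-r = go 0 refl (<-wellFounded _)
      where
      go : ∀ i {h} → height (key (state-of (branch i))) ≡ h → Acc _<_ h → ⊥
      go i refl (acc rs) with j , i≤j , f ← acc-r path i with k , j≤k , g ← visits j
        with descends (ℕ.≤⇒≤′ j≤k)
      ... | inj₂ same = F-G-apart f g (sym same)
      ... | inj₁ lower with descends (ℕ.≤⇒≤′ i≤j)
      ...   | inj₁ lower′ = go k refl (rs (ℕ.<-trans lower lower′))
      ...   | inj₂ same   = go k refl (rs (subst (λ c → height (key (state-of (branch k))) < height c) same lower))

-- Valuations of path formulae and aperiodicity of their update.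

-- A valuation records the truth value of every path subformula on a finite
-- suffix of a word; on ∧ and ∨ it is determined by the immediate subformulae.
Val : ∀ {n} → PathFormula n → Set
Val (state φ) = Bool
Val (ψ and χ) = Val ψ × Val χ
Val (ψ or χ)  = Val ψ × Val χ
Val (X ψ)     = Bool × Val ψ
Val (ψ U χ)   = Bool × Val ψ × Val χ

-- One Boolean per maximal state subformula: all that the current node contributes.
Letter : ∀ {n} → PathFormula n → Set
Letter (state φ) = Bool
Letter (ψ and χ) = Letter ψ × Letter χ
Letter (ψ or χ)  = Letter ψ × Letter χ
Letter (X ψ)     = Letter ψ
Letter (ψ U χ)   = Letter ψ × Letter χ

value : ∀ {n} (ψ : PathFormula n) → Val ψ → Bool
value (state φ) b       = b
value (ψ and χ) (v , w) = value ψ v Bool.∧ value χ w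
value (ψ or χ)  (v , w) = value ψ v Bool.∨ value χ w
value (X ψ)     (b , _) = b
value (ψ U χ)   (b , _) = b

-- The valuation on a·w is computed from the letter a and the valuation on w,
-- so the word automaton v –a→ v′ iff v = step a v′ is reverse deterministic.
step : ∀ {n} (ψ : PathFormula n) → Letter ψ → Val ψ → Val ψ
step (state φ) a       _           = a
step (ψ and χ) (a , b) (v , w)     = step ψ a v , step χ b w
step (ψ or χ)  (a , b) (v , w)     = step ψ a v , step χ b w
step (X ψ)     a       (_ , v)     = value ψ v , step ψ a v
-- Expansion law: an until holds if χ does, or if ψ does and the until holds one step later. The
-- later bit `c` enters positively.
step (ψ U χ)   (a , b) (c , v , w) =
  value χ (step χ b w) Bool.∨ (value ψ (step ψ a v) Bool.∧ c) , step ψ a v , step χ b w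

-- Strong finite-word semantics: nothing, not even a state formula, holds on the
-- empty word.  Leaving the component resumes with this valuation.
empty : ∀ {n} (ψ : PathFormula n) → Val ψ
empty (state φ) = Bool.false
empty (ψ and χ) = empty ψ , empty χ
empty (ψ or χ)  = empty ψ , empty χ
empty (X ψ)     = Bool.false , empty ψ
empty (ψ U χ)   = Bool.false , empty ψ , empty χ

bools : List Bool
bools = Bool.false ∷ Bool.true ∷ []

∈-bools : ∀ b → b ∈ bools
∈-bools Bool.false = here refl
∈-bools Bool.true  = there (here refl)

vals : ∀ {n} (ψ : PathFormula n) → List (Val ψ)
vals (state φ) = bools
vals (ψ and χ) = cartesianProduct (vals ψ) (vals χ)
vals (ψ or χ)  = cartesianProduct (vals ψ) (vals χ)
vals (X ψ)     = cartesianProduct bools (vals ψ)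
vals (ψ U χ)   = cartesianProduct bools (cartesianProduct (vals ψ) (vals χ))

∈-vals : ∀ {n} (ψ : PathFormula n) v → v ∈ vals ψ
∈-vals (state φ) b           = ∈-bools b
∈-vals (ψ and χ) (v , w)     = ∈-cartesianProduct⁺ (∈-vals ψ v) (∈-vals χ w)
∈-vals (ψ or χ)  (v , w)     = ∈-cartesianProduct⁺ (∈-vals ψ v) (∈-vals χ w)
∈-vals (X ψ)     (b , v)     = ∈-cartesianProduct⁺ (∈-bools b) (∈-vals ψ v)
∈-vals (ψ U χ)   (b , v , w) = ∈-cartesianProduct⁺ (∈-bools b) (∈-cartesianProduct⁺ (∈-vals ψ v) (∈-vals χ w))

iter : {A : Set} → ℕ → (A → A) → A → A
iter zero    f x = x
iter (suc k) f x = f (iter k f x)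

iter-commute : ∀ {A B : Set} {f : A → A} {g : B → B} (h : A → B) → (∀ x → h (f x) ≡ g (h x)) →
  ∀ k x → h (iter k f x) ≡ iter k g (h x)
iter-commute         h eq zero    x = refl
iter-commute {g = g} h eq (suc k) x = trans (eq _) (cong g (iter-commute h eq k x))

iter-fixed : ∀ {A : Set} {f : A → A} {x} → f x ≡ x → ∀ k → iter k f x ≡ x
iter-fixed         eq zero    = refl
iter-fixed {f = f} eq (suc k) = trans (cong f (iter-fixed eq k)) eq

ConstantBit IdentityBit : {V : Set} → (Bool × V → Bool × V) → V → Set
ConstantBit f v = ∀ b c → f (b , v) ≡ f (c , v)
IdentityBit f v = ∀ b → proj₁ (f (b , v)) ≡ b

-- A monotone self-map of Bool is constant or the identity, so it has no
-- nontrivial cycles.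
bit-aperiodic : ∀ {V : Set} {f : Bool × V → Bool × V} {g : V → V} {v} →
  (∀ x → proj₂ (f x) ≡ g (proj₂ x)) → g v ≡ v → ConstantBit f v ⊎ IdentityBit f v →
  ∀ k b → iter (suc k) f (b , v) ≡ (b , v) → f (b , v) ≡ (b , v)
bit-aperiodic fg fix (inj₂ id-bit) k b _ = cong₂ _,_ (id-bit b) (trans (fg _) fix)
bit-aperiodic {f = f} {v = v} fg fix (inj₁ const) k b cycle =
  trans (const b (proj₁ (iter k f (b , v)))) (trans (cong (λ w → f (proj₁ (iter k f (b , v)) , w)) (sym settled)) cycle)
  where
  settled : proj₂ (iter k f (b , v)) ≡ v
  settled = trans (iter-commute proj₂ fg k (b , v)) (iter-fixed fix k)

module _ {n : ℕ} where

  steps : (ψ : PathFormula n) → List (Letter ψ) → Val ψ → Val ψ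
  steps ψ u v = foldr (step ψ) v u

  steps-power : ∀ ψ k u v → steps ψ (concat (replicate k u)) v ≡ iter k (steps ψ u) v
  steps-power ψ zero    u v = refl
  steps-power ψ (suc k) u v =
    trans (foldr-++ (step ψ) v u (concat (replicate k u))) (cong (steps ψ u) (steps-power ψ k u v))

  steps-X : ∀ ψ u v → proj₂ (steps (X ψ) u v) ≡ steps ψ u (proj₂ v)
  steps-X ψ []      v = refl
  steps-X ψ (a ∷ u) v = cong (step ψ a) (steps-X ψ u v)

  steps-and : ∀ ψ χ u v →
    steps (ψ and χ) u v ≡ (steps ψ (map proj₁ u) (proj₁ v) , steps χ (map proj₂ u) (proj₂ v))
  steps-and ψ χ []      v = refl
  steps-and ψ χ (a ∷ u) v = cong (step (ψ and χ) a) (steps-and ψ χ u v)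

  steps-or : ∀ ψ χ u v → steps (ψ or χ) u v ≡ steps (ψ and χ) u v
  steps-or ψ χ []      v = refl
  steps-or ψ χ (a ∷ u) v = cong (step (ψ or χ) a) (steps-or ψ χ u v)

  steps-U : ∀ ψ χ u v → proj₂ (steps (ψ U χ) u v) ≡ steps (ψ and χ) u (proj₂ v)
  steps-U ψ χ []      v = refl
  steps-U ψ χ (a ∷ u) v = cong (step (ψ and χ) a) (steps-U ψ χ u v)

  -- Over fixed lower valuations, a letter acts on the bit as b ↦ x ∨ (y ∧ b): constant if x holds
  -- or y fails, the identity otherwise. Such maps are closed under composition.
  U-bit : ∀ ψ χ u v → ConstantBit (steps (ψ U χ) u) v ⊎ IdentityBit (steps (ψ U χ) u) v
  U-bit ψ χ []      v = inj₂ λ b → refl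
  U-bit ψ χ (a@(a₁ , a₂) ∷ u) v with U-bit ψ χ u v
  ... | inj₁ const = inj₁ λ b c → cong (step (ψ U χ) a) (const b c)
  ... | inj₂ id-bit = helper _ refl _ refl
    where
    w : Val (ψ and χ)
    w = steps (ψ and χ) u v

    unfold : ∀ b → steps (ψ U χ) (a ∷ u) (b , v) ≡ step (ψ U χ) a (b , w)
    unfold b = cong (step (ψ U χ) a) (cong₂ _,_ (id-bit b) (steps-U ψ χ u (b , v)))

    helper : ∀ x → value χ (step χ a₂ (proj₂ w)) ≡ x → ∀ y → value ψ (step ψ a₁ (proj₁ w)) ≡ y →
      ConstantBit (steps (ψ U χ) (a ∷ u)) v ⊎ IdentityBit (steps (ψ U χ) (a ∷ u)) v
    helper Bool.true  eq _ _ = inj₁ λ b c → trans (unfold b) (trans (constant b c) (sym (unfold c)))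
      where
      constant : ∀ b c → step (ψ U χ) a (b , w) ≡ step (ψ U χ) a (c , w)
      constant b c rewrite eq = refl
    helper Bool.false eq Bool.false eq′ = inj₁ λ b c → trans (unfold b) (trans (constant b c) (sym (unfold c)))
      where
      constant : ∀ b c → step (ψ U χ) a (b , w) ≡ step (ψ U χ) a (c , w)
      constant b c rewrite eq | eq′ = refl
    helper Bool.false eq Bool.true eq′ = inj₂ λ b → trans (cong proj₁ (unfold b)) (identity b)
      where
      identity : ∀ b → proj₁ (step (ψ U χ) a (b , w)) ≡ b
      identity b rewrite eq | eq′ = refl

  -- Induction on ψ as in a cascade product: the lower valuations lie on a cycle, hence are fixed by
  -- induction, and over a fixed point the bit moves by a constant map or the identity.
  steps-aperiodic : ∀ ψ u k v → iter (suc k) (steps ψ u) v ≡ v → steps ψ u v ≡ v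
  and-aperiodic : ∀ ψ χ u k v → iter (suc k) (steps (ψ and χ) u) v ≡ v → steps (ψ and χ) u v ≡ v

  steps-aperiodic (state φ) []      k v eq = refl
  steps-aperiodic (state φ) (a ∷ u) k v eq = eq
  steps-aperiodic (ψ and χ) u k v eq = and-aperiodic ψ χ u k v eq
  steps-aperiodic (ψ or χ) u k v eq = trans (steps-or ψ χ u v)
    (and-aperiodic ψ χ u k v (trans (sym (iter-commute id (steps-or ψ χ u) (suc k) v)) eq))
  steps-aperiodic (X ψ) u k (b , v) eq =
    bit-aperiodic (steps-X ψ u) fix (bit u) k b eq
    where
    fix : steps ψ u v ≡ v
    fix = steps-aperiodic ψ u k v (trans (sym (iter-commute proj₂ (steps-X ψ u) (suc k) (b , v))) (cong proj₂ eq))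

    bit : ∀ u → ConstantBit (steps (X ψ) u) v ⊎ IdentityBit (steps (X ψ) u) v
    bit []      = inj₂ λ b → refl
    -- A nonempty word overwrites the bit of `X`, since the new bit is read from the valuation below
    -- it.
    bit (a ∷ u) = inj₁ λ b c →
      cong (λ w → value ψ w , step ψ a w) (trans (steps-X ψ u (b , v)) (sym (steps-X ψ u (c , v))))
  steps-aperiodic (ψ U χ) u k (b , v) eq =
    bit-aperiodic (steps-U ψ χ u) fix (U-bit ψ χ u v) k b eq
    where
    fix : steps (ψ and χ) u v ≡ v
    fix = and-aperiodic ψ χ u k v (trans (sym (iter-commute proj₂ (steps-U ψ χ u) (suc k) (b , v))) (cong proj₂ eq))

  and-aperiodic ψ χ u k v eq = trans (steps-and ψ χ u v) (cong₂ _,_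
    (steps-aperiodic ψ (map proj₁ u) k (proj₁ v)
      (trans (sym (iter-commute proj₁ (λ w → cong proj₁ (steps-and ψ χ u w)) (suc k) v)) (cong proj₁ eq)))
    (steps-aperiodic χ (map proj₂ u) k (proj₂ v)
      (trans (sym (iter-commute proj₂ (λ w → cong proj₂ (steps-and ψ χ u w)) (suc k) v)) (cong proj₂ eq))))

-- Finite prefixes of paths and the semantics of `E`.

from-does : ∀ {P : Set} (p? : Dec P) → does p? ≡ Bool.true → P
from-does (yes p) _ = p

module Paths (em : ExcludedMiddle (lsuc 0ℓ)) {n : ℕ} (t : Tree n) where
  open Classical em
  open Tree t

  truth : ∀ ψ → Node → Letter ψ
  truth (state φ) u = does (lem (Sat t φ u))
  truth (ψ and χ) u = truth ψ u , truth χ u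
  truth (ψ or χ)  u = truth ψ u , truth χ u
  truth (X ψ)     u = truth ψ u
  truth (ψ U χ)   u = truth ψ u , truth χ u

  -- v is the valuation on some finite path from u with d edges.
  Reach : ∀ ψ → Val ψ → Node → ℕ → Set
  Reach ψ v u zero    = v ≡ step ψ (truth ψ u) (empty ψ)
  Reach ψ v u (suc d) = ∃[ u′ ] ∃[ v′ ] (u ⟶ u′ × Reach ψ v′ u′ d × v ≡ step ψ (truth ψ u) v′)

  module _ (s : ℕ → Node) where

    -- The last argument counts nodes, whereas `Reach` counts edges; hence the `suc d` wherever the
    -- two are compared.
    trace : ∀ ψ → ℕ → ℕ → Val ψ
    trace ψ i zero    = empty ψ
    trace ψ i (suc m) = step ψ (truth ψ (s i)) (trace ψ (suc i) m)

    trace-and : ∀ ψ χ i m → trace (ψ and χ) i m ≡ (trace ψ i m , trace χ i m)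
    trace-and ψ χ i zero    = refl
    trace-and ψ χ i (suc m) = cong (step (ψ and χ) (truth (ψ and χ) (s i))) (trace-and ψ χ (suc i) m)

    trace-or : ∀ ψ χ i m → trace (ψ or χ) i m ≡ (trace ψ i m , trace χ i m)
    trace-or ψ χ i zero    = refl
    trace-or ψ χ i (suc m) = cong (step (ψ or χ) (truth (ψ or χ) (s i))) (trace-or ψ χ (suc i) m)

    trace-X : ∀ ψ i m → proj₂ (trace (X ψ) i m) ≡ trace ψ i m
    trace-X ψ i zero    = refl
    trace-X ψ i (suc m) = cong (step ψ (truth ψ (s i))) (trace-X ψ (suc i) m)

    trace-U : ∀ ψ χ i m → proj₂ (trace (ψ U χ) i m) ≡ (trace ψ i m , trace χ i m)
    trace-U ψ χ i zero    = refl
    trace-U ψ χ i (suc m) = cong (step (ψ and χ) (truth (ψ and χ) (s i))) (trace-U ψ χ (suc i) m)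

    value-U : ∀ ψ χ i m → value (ψ U χ) (trace (ψ U χ) i (suc m)) ≡
      value χ (trace χ i (suc m)) Bool.∨ (value ψ (trace ψ i (suc m)) Bool.∧ value (ψ U χ) (trace (ψ U χ) (suc i) m))
    value-U ψ χ i m = cong (λ w → value χ (step χ (truth χ (s i)) (proj₂ w)) Bool.∨
      (value ψ (step ψ (truth ψ (s i)) (proj₁ w)) Bool.∧ value (ψ U χ) (trace (ψ U χ) (suc i) m))) (trace-U ψ χ (suc i) m)

  trace-cong : ∀ ψ {s s′ : ℕ → Node} {i i′} → (∀ k → s (k ℕ.+ i) ≡ s′ (k ℕ.+ i′)) →
    ∀ m → trace s ψ i m ≡ trace s′ ψ i′ m
  trace-cong ψ eq zero = refl
  trace-cong ψ {s} {s′} {i} {i′} eq (suc m) = cong₂ (step ψ) (cong (truth ψ) (eq 0)) (trace-cong ψ shifted m)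
    where
    shifted : ∀ k → s (k ℕ.+ suc i) ≡ s′ (k ℕ.+ suc i′)
    shifted k rewrite ℕ.+-suc k i | ℕ.+-suc k i′ = eq (suc k)

  module _ (π : InfinitePath) where
    open InfinitePath π using (at)

    TraceSound : PathFormula n → Set
    TraceSound ψ = ∀ i m → value ψ (trace at ψ i m) ≡ Bool.true → PathSat t ψ π i

    U-sound : ∀ ψ χ → TraceSound ψ → TraceSound χ → TraceSound (ψ U χ)
    U-sound ψ χ soundψ soundχ i (suc m) eq rewrite value-U at ψ χ i m with value χ (trace at χ i (suc m)) in eq₁
    ... | Bool.true = i , ℕ.≤-refl , soundχ i (suc m) eq₁ , λ k i≤k k<i → ⊥-elim (ℕ.<⇒≱ k<i i≤k)
    ... | Bool.false with value ψ (trace at ψ i (suc m)) in eq₂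
    ...   | Bool.true with j , i<j , now , before ← U-sound ψ χ soundψ soundχ (suc i) m eq =
      j , ℕ.<⇒≤ i<j , now , earlier
      where
      earlier : ∀ k → i ≤ k → k < j → PathSat t ψ π k
      earlier k i≤k k<j with ℕ.m≤n⇒m<n∨m≡n i≤k
      ... | inj₁ i<k  = before k i<k k<j
      ... | inj₂ refl = soundψ i (suc m) eq₂

    -- Path formulae are positive and everything beyond the cut counts as false, so truth on a
    -- prefix survives every continuation.
    trace-sound : ∀ ψ → TraceSound ψ
    trace-sound (state φ) i (suc m) eq = from-does (lem (Sat t φ (at i))) eq
    trace-sound (ψ and χ) i m eq rewrite trace-and at ψ χ i m
      with x , y ← Bool.∧-conicalˡ (value ψ (trace at ψ i m)) _ eq , Bool.∧-conicalʳ (value ψ (trace at ψ i m)) _ eq =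
      trace-sound ψ i m x , trace-sound χ i m y
    trace-sound (ψ or χ) i m eq rewrite trace-or at ψ χ i m with value ψ (trace at ψ i m) in eq₁
    ... | Bool.true  = inj₁ (trace-sound ψ i m eq₁)
    ... | Bool.false = inj₂ (trace-sound χ i m eq)
    trace-sound (X ψ) i (suc m) eq = trace-sound ψ (suc i) m (trans (cong (value ψ) (sym (trace-X at ψ (suc i) m))) eq)
    trace-sound (ψ U χ) i m eq = U-sound ψ χ (trace-sound ψ) (trace-sound χ) i m eq

    -- Truth on all long prefixes instead of some prefix: subformulae with different bounds can then
    -- be evaluated on a common one.
    Eventually : ∀ ψ → ℕ → Set
    Eventually ψ i = ∃[ m ] (∀ m′ → m ≤ m′ → value ψ (trace at ψ i m′) ≡ Bool.true)

    eventually-U : ∀ ψ χ e i → Eventually χ (e ℕ.+ i) → (∀ k → i ≤ k → k < e ℕ.+ i → Eventually ψ k) →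
      Eventually (ψ U χ) i
    eventually-U ψ χ zero i (m , h) _ = suc m , λ where
      (suc m′) (ℕ.s≤s m≤) → trans (value-U at ψ χ i m′)
        (cong (Bool._∨ (value ψ (trace at ψ i (suc m′)) Bool.∧ value (ψ U χ) (trace at (ψ U χ) (suc i) m′)))
          (h (suc m′) (ℕ.m≤n⇒m≤1+n m≤)))
    eventually-U ψ χ (suc e) i now before
      with m₁ , h₁ ← before i ℕ.≤-refl (ℕ.s≤s (ℕ.m≤n+m i e))
      with m₂ , h₂ ← eventually-U ψ χ e (suc i) (subst (Eventually χ) (sym (ℕ.+-suc e i)) now)
                       (λ k i<k k< → before k (ℕ.<⇒≤ i<k) (subst (k <_) (ℕ.+-suc e i) k<)) =
      suc (m₁ ℕ.⊔ m₂) , λ where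
        (suc m′) (ℕ.s≤s m≤) → trans (value-U at ψ χ i m′) (trans
          (cong (value χ (trace at χ i (suc m′)) Bool.∨_)
            (cong₂ Bool._∧_ (h₁ (suc m′) (ℕ.m≤n⇒m≤1+n (ℕ.≤-trans (ℕ.m≤m⊔n m₁ m₂) m≤)))
                            (h₂ m′ (ℕ.≤-trans (ℕ.m≤n⊔m m₁ m₂) m≤))))
          (Bool.∨-zeroʳ (value χ (trace at χ i (suc m′)))))

    trace-complete : ∀ ψ i → PathSat t ψ π i → Eventually ψ i
    trace-complete (state φ) i p = 1 , λ { (suc m′) _ → Dec.dec-true (lem (Sat t φ (at i))) p }
    trace-complete (ψ and χ) i (p , q)
      with m₁ , h₁ ← trace-complete ψ i p | m₂ , h₂ ← trace-complete χ i q =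
      m₁ ℕ.⊔ m₂ , λ m′ m≤ → trans (cong (value (ψ and χ)) (trace-and at ψ χ i m′))
        (cong₂ Bool._∧_ (h₁ m′ (ℕ.≤-trans (ℕ.m≤m⊔n m₁ m₂) m≤)) (h₂ m′ (ℕ.≤-trans (ℕ.m≤n⊔m m₁ m₂) m≤)))
    trace-complete (ψ or χ) i (inj₁ p) with m , h ← trace-complete ψ i p =
      m , λ m′ m≤ → trans (cong (value (ψ or χ)) (trace-or at ψ χ i m′))
        (cong (Bool._∨ value χ (trace at χ i m′)) (h m′ m≤))
    trace-complete (ψ or χ) i (inj₂ q) with m , h ← trace-complete χ i q =
      m , λ m′ m≤ → trans (cong (value (ψ or χ)) (trace-or at ψ χ i m′))
        (trans (cong (value ψ (trace at ψ i m′) Bool.∨_) (h m′ m≤)) (Bool.∨-zeroʳ _))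
    trace-complete (X ψ) i p with m , h ← trace-complete ψ (suc i) p =
      suc m , λ { (suc m′) (ℕ.s≤s m≤) → trans (cong (value ψ) (trace-X at ψ (suc i) m′)) (h m′ m≤) }
    trace-complete (ψ U χ) i (j , i≤j , now , before) =
      eventually-U ψ χ (j ℕ.∸ i) i (subst (Eventually χ) (sym (ℕ.m∸n+n≡m i≤j)) (trace-complete χ j now))
        (λ k i≤k k< → trace-complete ψ k (before k i≤k (subst (k <_) (ℕ.m∸n+n≡m i≤j) k<)))

  trace-reach : ∀ ψ {s : ℕ → Node} → (∀ i → s i ⟶ s (suc i)) → ∀ d i → Reach ψ (trace s ψ i (suc d)) (s i) d
  trace-reach ψ edges zero    i = refl
  trace-reach ψ edges (suc d) i = _ , _ , edges i , trace-reach ψ edges d (suc i) , refl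

  Ray : Node → Set
  Ray u = Σ[ s ∈ (ℕ → Node) ] s 0 ≡ u × (∀ i → s i ⟶ s (suc i))

  some-ray : ∀ u → Ray u
  some-ray u = s , refl , λ i → proj₂ (leafless (s i))
    where
    s : ℕ → Node
    s zero    = u
    s (suc i) = proj₁ (leafless (s i))

  cons-ray : ∀ {u v} → u ⟶ v → Ray v → Ray u
  cons-ray {u} e (s , refl , edges) =
    (λ { zero → u ; (suc i) → s i }) , refl , λ { zero → e ; (suc i) → edges i }

  -- As the tree is leafless, a finite witness extends to an infinite path, and the valuation
  -- depends only on the first `suc d` nodes.
  reach-trace : ∀ ψ d {v u} → Reach ψ v u d → Σ[ r ∈ Ray u ] trace (proj₁ r) ψ 0 (suc d) ≡ v
  reach-trace ψ zero    {u = u} eq = some-ray u , sym eq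
  reach-trace ψ (suc d) {u = u} (u′ , v′ , e , r , refl) with (s , refl , edges) , refl ← reach-trace ψ d r =
    cons-ray e (s , refl , edges) , cong (step ψ (truth ψ u)) (trace-cong ψ {i = 1} {0} shift (suc d))
    where
    shift : ∀ k → proj₁ (cons-ray e (s , refl , edges)) (k ℕ.+ 1) ≡ s (k ℕ.+ 0)
    shift k rewrite ℕ.+-suc k 0 = refl

  prefix-ray : ∀ {x u} → Star _⟶_ x u → (r : Ray u) →
    Σ[ r′ ∈ Ray x ] Σ[ i ∈ ℕ ] (∀ k → proj₁ r′ (k ℕ.+ i) ≡ proj₁ r k)
  prefix-ray ε       r = r , 0 , λ k → cong (proj₁ r) (ℕ.+-identityʳ k)
  prefix-ray (e ◅ es) r with (s , refl , edges) , i , eq ← prefix-ray es r =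
    cons-ray e (s , refl , edges) , suc i , shift
    where
    shift : ∀ k → proj₁ (cons-ray e (s , refl , edges)) (k ℕ.+ suc i) ≡ proj₁ r k
    shift k rewrite ℕ.+-suc k i = eq k

  E⇒Reach : ∀ ψ u → Sat t (E ψ) u → ∃[ v ] (value ψ v ≡ Bool.true × ∃[ d ] Reach ψ v u d)
  E⇒Reach ψ _ (π , i , refl , p) with m , h ← trace-complete π ψ i p =
    _ , h (suc m) (ℕ.n≤1+n m) , m , trace-reach ψ (InfinitePath.step π) m i

  Reach⇒E : ∀ ψ {u v d} → value ψ v ≡ Bool.true → Reach ψ v u d → Sat t (E ψ) u
  Reach⇒E ψ {u} {d = d} val r with (s , refl , edges) , refl ← reach-trace ψ d r
    with (s′ , start , edges′) , i , eq ← prefix-ray (reachable u) (s , refl , edges) =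
    π , i , eq 0 , trace-sound π ψ i (suc d) (trans (cong (value ψ) (trace-cong ψ {i = i} {0} shift (suc d))) val)
    where
    π : InfinitePath
    π = record { at = s′ ; starts = start ; step = edges′ }
    shift : ∀ k → s′ (k ℕ.+ i) ≡ s (k ℕ.+ 0)
    shift k = trans (eq k) (cong s (sym (ℕ.+-identityʳ k)))

-- Occurrences of subformulae and their order.

-- Subformulae that need states of their own: next φ reads φ at the current
-- node (for D k φ), along ψ tracks a path (for E ψ).
data Entry (n : ℕ) : Set where
  next  : StateFormula n → Entry n
  along : PathFormula n → Entry n

module _ {n : ℕ} where

  entriesˢ : StateFormula n → List (Entry n)
  entriesᵖ : PathFormula n → List (Entry n)

  entriesˢ (prop p) = []
  entriesˢ (neg φ)  = entriesˢ φ
  entriesˢ (φ or χ) = entriesˢ φ ++ entriesˢ χ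
  entriesˢ (D k φ)  = next φ ∷ entriesˢ φ
  entriesˢ (E ψ)    = along ψ ∷ entriesᵖ ψ

  entriesᵖ (state φ) = entriesˢ φ
  entriesᵖ (ψ and χ) = entriesᵖ ψ ++ entriesᵖ χ
  entriesᵖ (ψ or χ)  = entriesᵖ ψ ++ entriesᵖ χ
  entriesᵖ (X ψ)     = entriesᵖ ψ
  entriesᵖ (ψ U χ)   = entriesᵖ ψ ++ entriesᵖ χ

  below : Entry n → List (Entry n)
  below (next φ)  = entriesˢ φ
  below (along ψ) = entriesᵖ ψ

  -- Dependencies point into the tail, so the position in the list can serve as the order of the
  -- components.
  data Closed : List (Entry n) → Set where
    []  : Closed []
    _∷_ : ∀ {e L} → below e List.⊆ L → Closed L → Closed (e ∷ L)

  closed-++ : ∀ {L M} → Closed L → Closed M → Closed (L ++ M)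
  closed-++ []       d = d
  closed-++ (s ∷ c) d = (∈-++⁺ˡ ∘ s) ∷ closed-++ c d

  closedˢ : ∀ φ → Closed (entriesˢ φ)
  closedᵖ : ∀ ψ → Closed (entriesᵖ ψ)

  closedˢ (prop p) = []
  closedˢ (neg φ)  = closedˢ φ
  closedˢ (φ or χ) = closed-++ (closedˢ φ) (closedˢ χ)
  closedˢ (D k φ)  = id ∷ closedˢ φ
  closedˢ (E ψ)    = id ∷ closedᵖ ψ

  closedᵖ (state φ) = closedˢ φ
  closedᵖ (ψ and χ) = closed-++ (closedᵖ ψ) (closedᵖ χ)
  closedᵖ (ψ or χ)  = closed-++ (closedᵖ ψ) (closedᵖ χ)
  closedᵖ (X ψ)     = closedᵖ ψ
  closedᵖ (ψ U χ)   = closed-++ (closedᵖ ψ) (closedᵖ χ)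

module _ {A : Set} where

  -- Counted from the end of the list, so that the entries below e, which come
  -- after e, get smaller levels.
  level : ∀ {a : A} {L} → a ∈ L → Fin (length L)
  level {L = _ ∷ L} (here _)  = Fin.fromℕ (length L)
  level             (there p) = Fin.inject₁ (level p)

  position : ∀ (L : List A) → Fin (length L) → ∃[ a ] (a ∈ L)
  position (a ∷ L) i with view i
  ... | ‵fromℕ     = a , here refl
  ... | ‵inject₁ j = Product.map₂ there (position L j)

  position-level : ∀ {a : A} {L} (p : a ∈ L) → position L (level p) ≡ (a , p)
  position-level {L = _ ∷ L} (here refl) rewrite view-fromℕ (length L) = refl
  position-level (there p) rewrite view-inject₁ (level p) | position-level p = refl

  level-position : ∀ (L : List A) i → level (proj₂ (position L i)) ≡ i
  level-position (a ∷ L) i with view i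
  ... | ‵fromℕ     = refl
  ... | ‵inject₁ j = cong Fin.inject₁ (level-position L j)

lower-entry : ∀ {n} {L : List (Entry n)} → Closed L → ∀ {e} (p : e ∈ L) {e′} → e′ ∈ below e →
  Σ[ p′ ∈ e′ ∈ L ] level p′ Fin.< level p
lower-entry {L = _ ∷ L} (s ∷ c) (here refl) x =
  there (s x) , subst (Fin.toℕ (Fin.inject₁ (level (s x))) <_) (sym (Fin.toℕ-fromℕ (length L))) (Fin.inject₁ℕ< (level (s x)))
lower-entry (s ∷ c) (there p) x with p′ , p′<p ← lower-entry c p x =
  there p′ , subst (λ l → l < Fin.toℕ (Fin.inject₁ (level p))) (sym (Fin.toℕ-inject₁ (level p′)))
               (subst (Fin.toℕ (level p′) <_) (sym (Fin.toℕ-inject₁ (level p))) p′<p)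

subsets : ∀ n → List (Subset n)
subsets zero    = [ [] ]
subsets (suc n) = cartesianProductWith _∷_ bools (subsets n)

∈-subsets : ∀ {n} (σ : Subset n) → σ ∈ subsets n
∈-subsets []      = here refl
∈-subsets (b ∷ σ) = ∈-cartesianProductWith⁺ _∷_ (∈-bools b) (∈-subsets σ)

opposite : Polarity → Polarity
opposite existential = universal
opposite universal   = existential

opposite-involutive : ∀ b → opposite (opposite b) ≡ b
opposite-involutive existential = refl
opposite-involutive universal   = refl

flip-involutive : ∀ m → flip (flip m) ≡ m
flip-involutive (◇ k) = refl
flip-involutive (□ k) = refl

fromDec : ∀ {A P : Set} → Dec P → B⁺ A
fromDec (yes _) = true
fromDec (no _)  = false

-- The automaton.

module Construction (em : ExcludedMiddle (lsuc 0ℓ)) {n : ℕ} (L : List (Entry n)) (closed : Closed L) where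
  open Classical em

  St : Entry n → Set
  St (next φ)  = ⊤
  St (along ψ) = Val ψ

  -- The membership proof identifies an occurrence: repeated subformulae get separate components,
  -- and formulae are never compared.
  data Q : Set where
    mk : ∀ {e} → e ∈ L → St e → Polarity → Q

  Key : Set
  Key = (∃[ e ] (e ∈ L)) × Polarity

  key : Q → Key
  key (mk p s b) = (_ , p) , b

  height : Key → ℕ
  height ((_ , p) , _) = Fin.toℕ (level p)

  height-bounded : ∀ q → height (key q) < length L
  height-bounded (mk p s b) = Fin.toℕ<n (level p)

  atomHeight : Atom Q → ℕ
  atomHeight (_ , q) = height (key q)

  dual : Q → Q
  dual (mk p s b) = mk p s (opposite b)

  dual-involutive : ∀ q → dual (dual q) ≡ q
  dual-involutive (mk p s b) = cong (mk p s) (opposite-involutive b)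

  height-dual : ∀ q → height (key (dual q)) ≡ height (key q)
  height-dual (mk p s b) = refl

  dualAtom : Atom Q → Atom Q
  dualAtom (m , q) = flip m , dual q

  dualAtom-involutive : ∀ a → dualAtom (dualAtom a) ≡ a
  dualAtom-involutive (m , q) = cong₂ _,_ (flip-involutive m) (dual-involutive q)

  -- Each atom is chosen or its dual is: the annotations are complete
  -- valuations, and two different ones contain a complementary pair.
  choices : List (Atom Q) → List (List (Atom Q))
  choices []      = [ [] ]
  choices (a ∷ B) = map (a ∷_) (choices B) ++ map (dualAtom a ∷_) (choices B)

  resume : (ψ : PathFormula n) → Maybe (Val ψ) → Val ψ
  resume ψ = maybe id (empty ψ)

  own : ∀ {ψ} → along ψ ∈ L → Val ψ → Atom Q
  own p v = ◇ 1 , mk p v existential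

  clause : ∀ {ψ} → along ψ ∈ L → Maybe (Val ψ) × List (Atom Q) → List (Atom Q)
  clause p (nothing , C) = C
  clause p (just v  , C) = own p v ∷ C

  translate : ∀ φ → entriesˢ φ List.⊆ L → Subset n → B⁺ (Atom Q)
  letter    : ∀ ψ → entriesᵖ ψ List.⊆ L → Subset n → Pred (Atom Q) 0ℓ → Letter ψ
  -- Collected over all labels σ, so that all transitions of a component choose from the same list;
  -- otherwise two annotations might differ without containing a complementary pair.
  base      : ∀ ψ → entriesᵖ ψ List.⊆ L → List (Atom Q)
  -- `P` is the demand on the valuation at the current node: equality with the present state for a
  -- move inside the component, truth of ψ for entering it from `E ψ`, where the first step is taken
  -- at once.
  options   : ∀ ψ → entriesᵖ ψ List.⊆ L → Pred (Val ψ) 0ℓ → Subset n → List (Maybe (Val ψ) × List (Atom Q))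
  clauses   : ∀ ψ → entriesᵖ ψ List.⊆ L → along ψ ∈ L → Pred (Val ψ) 0ℓ → Subset n → List (List (Atom Q))

  translate (prop p) ρ σ = fromDec (p Subset.∈? σ)
  translate (neg φ)  ρ σ = dualise dualAtom (translate φ ρ σ)
  translate (φ or χ) ρ σ = translate φ (ρ ∘ ∈-++⁺ˡ) σ ∨ translate χ (ρ ∘ ∈-++⁺ʳ (entriesˢ φ)) σ
  translate (D k φ)  ρ σ = atom (◇ k , mk (ρ (here refl)) tt existential)
  translate (E ψ)    ρ σ = disj (clauses ψ (ρ ∘ there) (ρ (here refl)) (λ v → value ψ v ≡ Bool.true) σ)

  letter (state φ) ρ σ C = does (lem (⟦ translate φ ρ σ ⟧ C))
  letter (ψ and χ) ρ σ C = letter ψ (ρ ∘ ∈-++⁺ˡ) σ C , letter χ (ρ ∘ ∈-++⁺ʳ (entriesᵖ ψ)) σ C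
  letter (ψ or χ)  ρ σ C = letter ψ (ρ ∘ ∈-++⁺ˡ) σ C , letter χ (ρ ∘ ∈-++⁺ʳ (entriesᵖ ψ)) σ C
  letter (X ψ)     ρ σ C = letter ψ ρ σ C
  letter (ψ U χ)   ρ σ C = letter ψ (ρ ∘ ∈-++⁺ˡ) σ C , letter χ (ρ ∘ ∈-++⁺ʳ (entriesᵖ ψ)) σ C

  base (state φ) ρ = concatMap (λ σ → atoms (translate φ ρ σ)) (subsets n)
  base (ψ and χ) ρ = base ψ (ρ ∘ ∈-++⁺ˡ) ++ base χ (ρ ∘ ∈-++⁺ʳ (entriesᵖ ψ))
  base (ψ or χ)  ρ = base ψ (ρ ∘ ∈-++⁺ˡ) ++ base χ (ρ ∘ ∈-++⁺ʳ (entriesᵖ ψ))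
  base (X ψ)     ρ = base ψ ρ
  base (ψ U χ)   ρ = base ψ (ρ ∘ ∈-++⁺ˡ) ++ base χ (ρ ∘ ∈-++⁺ʳ (entriesᵖ ψ))

  options ψ ρ P σ =
    filter (λ (o , C) → lem (P (step ψ (letter ψ ρ σ (_∈ C)) (resume ψ o))))
           (cartesianProduct (nothing ∷ map just (vals ψ)) (choices (base ψ ρ)))

  clauses ψ ρ p P σ = map (clause p) (options ψ ρ P σ)

  ∈-clauses⁺ : ∀ ψ (ρ : entriesᵖ ψ List.⊆ L) p P σ o {C} → C ∈ choices (base ψ ρ) →
    P (step ψ (letter ψ ρ σ (_∈ C)) (resume ψ o)) → clause p (o , C) ∈ clauses ψ ρ p P σ
  ∈-clauses⁺ ψ ρ p P σ o C∈ x = ∈-map⁺ (clause p) (∈-filter⁺ _ (∈-cartesianProduct⁺ (listed o) C∈) x)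
    where
    listed : ∀ o → o ∈ nothing ∷ map just (vals ψ)
    listed nothing  = here refl
    listed (just v) = there (∈-map⁺ just (∈-vals ψ v))

  ∈-clauses⁻ : ∀ ψ (ρ : entriesᵖ ψ List.⊆ L) p P σ {c} → c ∈ clauses ψ ρ p P σ →
    ∃[ o ] ∃[ C ] (c ≡ clause p (o , C) × C ∈ choices (base ψ ρ) × P (step ψ (letter ψ ρ σ (_∈ C)) (resume ψ o)))
  ∈-clauses⁻ ψ ρ p P σ c∈ with (o , C) , oC∈ , refl ← ∈-map⁻ (clause p) c∈
    with oC∈′ , x ← ∈-filter⁻ (λ (o , C) → lem (P (step ψ (letter ψ ρ σ (_∈ C)) (resume ψ o))))
                      {xs = cartesianProduct (nothing ∷ map just (vals ψ)) (choices (base ψ ρ))} oC∈ =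
    o , C , refl , proj₂ (∈-cartesianProduct⁻ (nothing ∷ map just (vals ψ)) (choices (base ψ ρ)) oC∈′) , x

  ∈-clause⁻ : ∀ {ψ} (p : along ψ ∈ L) o {C a} → a ∈ clause p (o , C) → (∃[ v ] (o ≡ just v × a ≡ own p v)) ⊎ a ∈ C
  ∈-clause⁻ p nothing  a∈          = inj₂ a∈
  ∈-clause⁻ p (just v) (here refl) = inj₁ (v , refl , refl)
  ∈-clause⁻ p (just v) (there a∈)  = inj₂ a∈

  ⊆-clause : ∀ {ψ} (p : along ψ ∈ L) o {C a} → a ∈ C → a ∈ clause p (o , C)
  ⊆-clause p nothing  a∈ = a∈
  ⊆-clause p (just v) a∈ = there a∈

  choices-⊆ : ∀ B {C a} → C ∈ choices B → a ∈ C → ∃[ b ] (b ∈ B × (a ≡ b ⊎ a ≡ dualAtom b))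
  choices-⊆ [] (here refl) ()
  choices-⊆ (b ∷ B) C∈ a∈ with ∈-++⁻ (map (b ∷_) (choices B)) C∈
  ... | inj₁ C∈₁ with C′ , C′∈ , refl ← ∈-map⁻ _ C∈₁ with a∈
  ...   | here refl = b , here refl , inj₁ refl
  ...   | there a∈′ with b′ , b′∈ , eq ← choices-⊆ B C′∈ a∈′ = b′ , there b′∈ , eq
  choices-⊆ (b ∷ B) C∈ a∈ | inj₂ C∈₂ with C′ , C′∈ , refl ← ∈-map⁻ _ C∈₂ with a∈
  ...   | here refl = b , here refl , inj₂ refl
  ...   | there a∈′ with b′ , b′∈ , eq ← choices-⊆ B C′∈ a∈′ = b′ , there b′∈ , eq

  choices-complete : ∀ B {C a} → C ∈ choices B → a ∈ B → a ∈ C ⊎ dualAtom a ∈ C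
  choices-complete (b ∷ B) C∈ a∈ with ∈-++⁻ (map (b ∷_) (choices B)) C∈
  ... | inj₁ C∈₁ with C′ , C′∈ , refl ← ∈-map⁻ _ C∈₁ with a∈
  ...   | here refl = inj₁ (here refl)
  ...   | there a∈′ = Sum.map there there (choices-complete B C′∈ a∈′)
  choices-complete (b ∷ B) C∈ a∈ | inj₂ C∈₂ with C′ , C′∈ , refl ← ∈-map⁻ _ C∈₂ with a∈
  ...   | here refl = inj₂ (here refl)
  ...   | there a∈′ = Sum.map there there (choices-complete B C′∈ a∈′)

  choices-differ : ∀ B {C C′} → C ∈ choices B → C′ ∈ choices B → C ≡ C′ ⊎ ∃[ a ] (a ∈ C × dualAtom a ∈ C′)
  choices-differ [] (here refl) (here refl) = inj₁ refl
  choices-differ (b ∷ B) C∈ C′∈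
    with ∈-++⁻ (map (b ∷_) (choices B)) C∈ | ∈-++⁻ (map (b ∷_) (choices B)) C′∈
  ... | inj₁ x | inj₂ y with _ , _ , refl ← ∈-map⁻ _ x | _ , _ , refl ← ∈-map⁻ _ y =
    inj₂ (b , here refl , here refl)
  ... | inj₂ x | inj₁ y with _ , _ , refl ← ∈-map⁻ _ x | _ , _ , refl ← ∈-map⁻ _ y =
    inj₂ (dualAtom b , here refl , here (dualAtom-involutive b))
  ... | inj₁ x | inj₁ y with _ , D∈ , refl ← ∈-map⁻ _ x | _ , D′∈ , refl ← ∈-map⁻ _ y =
    Sum.map (cong (b ∷_)) (λ (a , a∈ , a′∈) → a , there a∈ , there a′∈) (choices-differ B D∈ D′∈)
  ... | inj₂ x | inj₂ y with _ , D∈ , refl ← ∈-map⁻ _ x | _ , D′∈ , refl ← ∈-map⁻ _ y =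
    Sum.map (cong (dualAtom b ∷_)) (λ (a , a∈ , a′∈) → a , there a∈ , there a′∈) (choices-differ B D∈ D′∈)

  choices-realised : ∀ {T : Pred (Atom Q) 0ℓ} → (∀ a → T a ⊎ T (dualAtom a)) → ∀ B →
    ∃[ C ] (C ∈ choices B × (∀ a → a ∈ C → T a))
  choices-realised ex []      = [] , here refl , λ _ ()
  choices-realised ex (b ∷ B) with choices-realised ex B | ex b
  ... | C , C∈ , all | inj₁ x = b ∷ C , ∈-++⁺ˡ (∈-map⁺ (b ∷_) C∈) , λ { _ (here refl) → x ; a (there a∈) → all a a∈ }
  ... | C , C∈ , all | inj₂ x = dualAtom b ∷ C , ∈-++⁺ʳ (map (b ∷_) (choices B)) (∈-map⁺ (dualAtom b ∷_) C∈)
                              , λ { _ (here refl) → x ; a (there a∈) → all a a∈ }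

  _LiesBelow_ : ∀ {xs} → xs List.⊆ L → ℕ → Set
  _LiesBelow_ {xs} ρ h = ∀ {e} (x : e ∈ xs) → Fin.toℕ (level (ρ x)) < h

  translate-below : ∀ φ (ρ : entriesˢ φ List.⊆ L) {h} → ρ LiesBelow h →
    ∀ σ {a} → a ∈ atoms (translate φ ρ σ) → atomHeight a < h
  base-below      : ∀ ψ (ρ : entriesᵖ ψ List.⊆ L) {h} → ρ LiesBelow h → ∀ {a} → a ∈ base ψ ρ → atomHeight a < h
  choices-below   : ∀ ψ (ρ : entriesᵖ ψ List.⊆ L) {h} → ρ LiesBelow h →
    ∀ {C a} → C ∈ choices (base ψ ρ) → a ∈ C → atomHeight a < h

  translate-below (prop p) ρ lt σ a∈ with p Subset.∈? σ
  translate-below (prop p) ρ lt σ () | yes _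
  translate-below (prop p) ρ lt σ () | no _
  translate-below (neg φ) ρ {h} lt σ a∈
    with b , b∈ , refl ← ∈-map⁻ dualAtom (subst (_ ∈_) (atoms-dualise dualAtom (translate φ ρ σ)) a∈) =
    subst (_< h) (sym (height-dual (proj₂ b))) (translate-below φ ρ lt σ b∈)
  translate-below (φ or χ) ρ lt σ a∈ with ∈-++⁻ (atoms (translate φ (ρ ∘ ∈-++⁺ˡ) σ)) a∈
  ... | inj₁ x = translate-below φ (ρ ∘ ∈-++⁺ˡ) (lt ∘ ∈-++⁺ˡ) σ x
  ... | inj₂ y = translate-below χ (ρ ∘ ∈-++⁺ʳ (entriesˢ φ)) (lt ∘ ∈-++⁺ʳ (entriesˢ φ)) σ y
  translate-below (D k φ) ρ lt σ (here refl) = lt (here refl)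
  translate-below (E ψ) ρ lt σ a∈
    with c , c∈ , a∈c ← atoms-disj⁻ (clauses ψ (ρ ∘ there) (ρ (here refl)) (λ v → value ψ v ≡ Bool.true) σ) a∈
    with o , C , refl , C∈ , _ ← ∈-clauses⁻ ψ (ρ ∘ there) (ρ (here refl)) (λ v → value ψ v ≡ Bool.true) σ c∈
    with ∈-clause⁻ (ρ (here refl)) o a∈c
  ... | inj₁ (_ , _ , refl) = lt (here refl)
  ... | inj₂ a∈C = choices-below ψ (ρ ∘ there) (lt ∘ there) C∈ a∈C

  base-below (state φ) ρ lt a∈
    with σ , _ , a∈σ ← find (∈-concatMap⁻ (λ σ → atoms (translate φ ρ σ)) {xs = subsets n} a∈) =
    translate-below φ ρ lt σ a∈σ
  base-below (ψ and χ) ρ lt a∈ with ∈-++⁻ (base ψ (ρ ∘ ∈-++⁺ˡ)) a∈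
  ... | inj₁ x = base-below ψ (ρ ∘ ∈-++⁺ˡ) (lt ∘ ∈-++⁺ˡ) x
  ... | inj₂ y = base-below χ (ρ ∘ ∈-++⁺ʳ (entriesᵖ ψ)) (lt ∘ ∈-++⁺ʳ (entriesᵖ ψ)) y
  base-below (ψ or χ) ρ lt a∈ with ∈-++⁻ (base ψ (ρ ∘ ∈-++⁺ˡ)) a∈
  ... | inj₁ x = base-below ψ (ρ ∘ ∈-++⁺ˡ) (lt ∘ ∈-++⁺ˡ) x
  ... | inj₂ y = base-below χ (ρ ∘ ∈-++⁺ʳ (entriesᵖ ψ)) (lt ∘ ∈-++⁺ʳ (entriesᵖ ψ)) y
  base-below (X ψ) ρ lt a∈ = base-below ψ ρ lt a∈
  base-below (ψ U χ) ρ lt a∈ with ∈-++⁻ (base ψ (ρ ∘ ∈-++⁺ˡ)) a∈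
  ... | inj₁ x = base-below ψ (ρ ∘ ∈-++⁺ˡ) (lt ∘ ∈-++⁺ˡ) x
  ... | inj₂ y = base-below χ (ρ ∘ ∈-++⁺ʳ (entriesᵖ ψ)) (lt ∘ ∈-++⁺ʳ (entriesᵖ ψ)) y

  choices-below ψ ρ lt C∈ a∈ with choices-⊆ (base ψ ρ) C∈ a∈
  ... | b , b∈ , inj₁ refl = base-below ψ ρ lt b∈
  ... | b , b∈ , inj₂ refl = subst (_< _) (sym (height-dual (proj₂ b))) (base-below ψ ρ lt b∈)

  embed : ∀ {e} → e ∈ L → below e List.⊆ L
  embed p x = proj₁ (lower-entry closed p x)

  embed-below : ∀ {e} (p : e ∈ L) → embed p LiesBelow Fin.toℕ (level p)
  embed-below p x = proj₂ (lower-entry closed p x)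

  δ⁺ : ∀ {e} → e ∈ L → St e → Subset n → B⁺ (Atom Q)
  δ⁺ {next φ}  p _ σ = translate φ (embed p) σ
  δ⁺ {along ψ} p v σ = disj (clauses ψ (embed p) p (v ≡_) σ)

  δ : Q → Subset n → B⁺ (Atom Q)
  δ (mk p s existential) σ = δ⁺ p s σ
  δ (mk p s universal)   σ = dualise dualAtom (δ⁺ p s σ)

  δ-dual : ∀ q σ → δ (dual q) σ ≡ dualise dualAtom (δ q σ)
  δ-dual (mk p s existential) σ = refl
  δ-dual (mk p s universal)   σ = sym (dualise-involutive dualAtom dualAtom-involutive (δ⁺ p s σ))

  F : Pred Q 0ℓ
  F (mk {next φ}  p s b)           = ⊥
  F (mk {along ψ} p s existential) = ⊥
  F (mk {along ψ} p s universal)   = ⊤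

  kindOf : Key → Kind
  kindOf ((next φ , _) , b)  = transient
  kindOf ((along ψ , _) , b) = nontransient b

  IsOwn : Q → Atom Q → Set
  IsOwn q (m , q′) = key q′ ≡ key q × kindOf (key q) ≡ nontransient (proj₂ (key q)) × m ≡ ownModality (proj₂ (key q))

  IsOwn-dual : ∀ {e} (p : e ∈ L) s a → IsOwn (mk p s existential) a → IsOwn (mk p s universal) (dualAtom a)
  IsOwn-dual {along ψ} p s (_ , mk _ _ _) (refl , _ , refl) = refl , refl , refl

  δ⁺-atoms : ∀ {e} (p : e ∈ L) s σ {a} → a ∈ atoms (δ⁺ p s σ) →
    atomHeight a < Fin.toℕ (level p) ⊎ IsOwn (mk p s existential) a
  δ⁺-atoms {next φ} p s σ a∈ = inj₁ (translate-below φ (embed p) (embed-below p) σ a∈)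
  δ⁺-atoms {along ψ} p v σ a∈
    with c , c∈ , a∈c ← atoms-disj⁻ (clauses ψ (embed p) p (v ≡_) σ) a∈
    with o , C , refl , C∈ , _ ← ∈-clauses⁻ ψ (embed p) p (v ≡_) σ c∈ with ∈-clause⁻ p o a∈c
  ... | inj₁ (_ , _ , refl) = inj₂ (refl , refl , refl)
  ... | inj₂ a∈C = inj₁ (choices-below ψ (embed p) (embed-below p) C∈ a∈C)

  -- The order and modality conditions of hesitancy are all read off from this dichotomy.
  δ-atoms : ∀ q σ {a} → a ∈ atoms (δ q σ) → atomHeight a < height (key q) ⊎ IsOwn q a
  δ-atoms (mk p s existential) σ a∈ = δ⁺-atoms p s σ a∈
  δ-atoms (mk p s universal) σ a∈
    with b , b∈ , refl ← ∈-map⁻ dualAtom (subst (_ ∈_) (atoms-dualise dualAtom (δ⁺ p s σ)) a∈)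
    with δ⁺-atoms p s σ b∈
  ... | inj₁ lower = inj₁ (subst (_< Fin.toℕ (level p)) (sym (height-dual (proj₂ b))) lower)
  ... | inj₂ isOwn = inj₂ (IsOwn-dual p s b isOwn)

  positions : List (∃[ e ] (e ∈ L))
  positions = map (position L) (allFin (length L))

  ∈-positions : ∀ {e} (p : e ∈ L) → (e , p) ∈ positions
  ∈-positions p = subst (_∈ positions) (position-level p) (∈-map⁺ (position L) (∈-allFin (level p)))

  polarities : List Polarity
  polarities = existential ∷ universal ∷ []

  ∈-polarities : ∀ b → b ∈ polarities
  ∈-polarities existential = here refl
  ∈-polarities universal   = there (here refl)

  local : ∀ e → List (St e)
  local (next φ)  = [ tt ]
  local (along ψ) = vals ψ

  ∈-local : ∀ e (s : St e) → s ∈ local e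
  ∈-local (next φ)  tt = here refl
  ∈-local (along ψ) v  = ∈-vals ψ v

  Q-finite : Finite Q
  Q-finite = concatMap statesAt positions , λ where
      (mk {e} p s b) → ∈-concatMap⁺ statesAt
        (lose (∈-positions p) (∈-cartesianProductWith⁺ (mk p) (∈-local e s) (∈-polarities b)))
    where
    statesAt : ∃[ e ] (e ∈ L) → List Q
    statesAt (e , p) = cartesianProductWith (mk p) (local e) polarities

  automaton : Q → TreeAutomaton n
  automaton q = record { Q = Q ; Q-finite = Q-finite ; δ = δ ; qI = q ; F = F }

  -- Correctness on a fixed tree.

  module Semantics (t : Tree n) where
    open Paths em t
    open Tree t
    open AtomSemantics t

    Meaning⁺ : ∀ e → St e → Node → ℕ → Set
    Meaning⁺ (next φ)  _ u d = Sat t φ u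
    Meaning⁺ (along ψ) v u d = Reach ψ v u d

    -- Only existential tracking states have a genuine rank; the others ignore it, and 0 is supplied
    -- where one is asked for.
    Meaning : Q → Node → ℕ → Set
    Meaning (mk {e} p s existential) u d = Meaning⁺ e s u d
    Meaning (mk {e} p s universal)   u d = ¬ (∃[ d ] Meaning⁺ e s u d)

    Holds : Q → Pred Node 0ℓ
    Holds q u = ∃[ d ] Meaning q u d

    Holds-exhaustive : ∀ q u → Holds q u ⊎ Holds (dual q) u
    Holds-exhaustive (mk {e} p s existential) u with lem (∃[ d ] Meaning⁺ e s u d)
    ... | yes x = inj₁ x
    ... | no ¬x = inj₂ (0 , ¬x)
    Holds-exhaustive (mk {e} p s universal) u with lem (∃[ d ] Meaning⁺ e s u d)
    ... | yes x = inj₂ x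
    ... | no ¬x = inj₁ (0 , ¬x)

    Holds-disjoint : ∀ q {u} → Holds q u → Holds (dual q) u → ⊥
    Holds-disjoint (mk p s existential) x (_ , ¬x) = ¬x x
    Holds-disjoint (mk p s universal) (_ , ¬x) x = ¬x x

    True : Node → Pred (Atom Q) 0ℓ
    True = AtomHolds Holds

    True-exhaustive : ∀ u a → True u a ⊎ True u (dualAtom a)
    True-exhaustive u (◇ k , q) =
      Sum.map₂ (AllBut-mono λ {v} _ ¬h → Sum.fromInj₂ (⊥-elim ∘ ¬h) (Holds-exhaustive q v))
        (AtLeast-or-AllBut (proj₂ (finitely-branching u)) k (Holds q))
    True-exhaustive u (□ k , q) =
      Sum.swap (Sum.map₂ (AllBut-mono λ {v} _ ¬h → Sum.fromInj₁ (⊥-elim ∘ ¬h) (Holds-exhaustive q v))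
        (AtLeast-or-AllBut (proj₂ (finitely-branching u)) k (Holds (dual q))))

    True-disjoint : ∀ u a → True u a → True u (dualAtom a) → ⊥
    True-disjoint u (m , q) x y with v , _ , h , h′ ← AtomHolds-meet {H = Holds} {Holds} m {q} {dual q} x y =
      Holds-disjoint q h h′

    Resumes : (ψ : PathFormula n) → Maybe (Val ψ) → Node → ℕ → Set
    Resumes ψ nothing  u d = ⊤
    Resumes ψ (just v) u d = ∃[ u′ ] ∃[ d′ ] (u ⟶ u′ × Reach ψ v u′ d′ × d′ < d)

    translate-sound    : ∀ φ (ρ : entriesˢ φ List.⊆ L) u → ⟦ translate φ ρ (label u) ⟧ (True u) → Sat t φ u
    translate-complete : ∀ φ (ρ : entriesˢ φ List.⊆ L) u → Sat t φ u → ⟦ translate φ ρ (label u) ⟧ (True u)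
    -- A true base atom must be in `C`: otherwise its dual would be, and would be true as well. So
    -- `C` agrees with the truth on every atom that the translations mention.
    letter-truth : ∀ ψ (ρ : entriesᵖ ψ List.⊆ L) u {C : Pred (Atom Q) 0ℓ} → (∀ a → a ∈ base ψ ρ → C a ⊎ C (dualAtom a)) →
      (∀ a → C a → True u a) → letter ψ ρ (label u) C ≡ truth ψ u
    clauses-sound : ∀ ψ (ρ : entriesᵖ ψ List.⊆ L) p (P : Pred (Val ψ) 0ℓ) u →
      ⟦ disj (clauses ψ ρ p P (label u)) ⟧ (True u) → ∃[ v ] (P v × ∃[ d ] Reach ψ v u d)
    clauses-complete : ∀ ψ (ρ : entriesᵖ ψ List.⊆ L) p (P : Pred (Val ψ) 0ℓ) u {v} d → P v → Reach ψ v u d →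
      ∃[ o ] ∃[ C ] (clause p (o , C) ∈ clauses ψ ρ p P (label u) × C ∈ choices (base ψ ρ) ×
                     (∀ a → a ∈ C → True u a) × Resumes ψ o u d)

    translate-sound (prop p) ρ u x with p Subset.∈? label u
    ... | yes p∈ = p∈
    translate-sound (neg φ) ρ u x sat
      with a , y , y′ ← dualise-disjoint dualAtom (translate φ ρ (label u)) (translate-complete φ ρ u sat) x =
      True-disjoint u a y y′
    translate-sound (φ or χ) ρ u (inj₁ x) = inj₁ (translate-sound φ (ρ ∘ ∈-++⁺ˡ) u x)
    translate-sound (φ or χ) ρ u (inj₂ y) = inj₂ (translate-sound χ (ρ ∘ ∈-++⁺ʳ (entriesˢ φ)) u y)
    translate-sound (D k φ) ρ u (f , f-inj , x) = f , f-inj , λ j → let e , _ , sat = x j in e , sat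
    translate-sound (E ψ) ρ u x
      with v , val , d , r ← clauses-sound ψ (ρ ∘ there) (ρ (here refl)) (λ v → value ψ v ≡ Bool.true) u x =
      Reach⇒E ψ val r

    translate-complete (prop p) ρ u sat with p Subset.∈? label u
    ... | yes _  = tt
    ... | no p∉ = p∉ sat
    translate-complete (neg φ) ρ u ¬sat
      with dualise-exhaustive dualAtom (True-exhaustive u) (translate φ ρ (label u))
    ... | inj₁ x = ⊥-elim (¬sat (translate-sound φ ρ u x))
    ... | inj₂ y = y
    translate-complete (φ or χ) ρ u (inj₁ x) = inj₁ (translate-complete φ (ρ ∘ ∈-++⁺ˡ) u x)
    translate-complete (φ or χ) ρ u (inj₂ y) = inj₂ (translate-complete χ (ρ ∘ ∈-++⁺ʳ (entriesˢ φ)) u y)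
    translate-complete (D k φ) ρ u (f , f-inj , x) = f , f-inj , λ j → let e , sat = x j in e , 0 , sat
    translate-complete (E ψ) ρ u sat with v , val , d , r ← E⇒Reach ψ u sat
      with clauses-complete ψ (ρ ∘ there) (ρ (here refl)) (λ v → value ψ v ≡ Bool.true) u d val r
    ... | nothing , C , c∈ , _ , all , _ = ⟦disj⟧⁺ c∈ all
    ... | just v′ , C , c∈ , _ , all , (u′ , d′ , e , r′ , _) = ⟦disj⟧⁺ c∈ λ where
      _ (here refl) → (λ _ → u′) , (λ { {Fin.zero} {Fin.zero} _ → refl }) , λ _ → e , d′ , r′
      a (there a∈)  → all a a∈

    letter-truth (state φ) ρ u {C} complete allTrue = Dec.does-⇔ (mk⇔ to from) (lem _) (lem _)
      where
      to : ⟦ translate φ ρ (label u) ⟧ C → Sat t φ u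
      to x = translate-sound φ ρ u (⟦⟧-mono (translate φ ρ (label u)) (λ a _ → allTrue a) x)

      member : ∀ a → a ∈ atoms (translate φ ρ (label u)) → True u a → C a
      member a a∈ x with complete a (∈-concatMap⁺ (λ σ → atoms (translate φ ρ σ)) (lose (∈-subsets (label u)) a∈))
      ... | inj₁ c  = c
      ... | inj₂ c′ = ⊥-elim (True-disjoint u a x (allTrue _ c′))

      from : Sat t φ u → ⟦ translate φ ρ (label u) ⟧ C
      from sat = ⟦⟧-mono (translate φ ρ (label u)) member (translate-complete φ ρ u sat)
    letter-truth (ψ and χ) ρ u complete allTrue = cong₂ _,_
      (letter-truth ψ (ρ ∘ ∈-++⁺ˡ) u (λ a → complete a ∘ ∈-++⁺ˡ) allTrue)
      (letter-truth χ (ρ ∘ ∈-++⁺ʳ (entriesᵖ ψ)) u (λ a → complete a ∘ ∈-++⁺ʳ (base ψ (ρ ∘ ∈-++⁺ˡ))) allTrue)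
    letter-truth (ψ or χ) ρ u complete allTrue = cong₂ _,_
      (letter-truth ψ (ρ ∘ ∈-++⁺ˡ) u (λ a → complete a ∘ ∈-++⁺ˡ) allTrue)
      (letter-truth χ (ρ ∘ ∈-++⁺ʳ (entriesᵖ ψ)) u (λ a → complete a ∘ ∈-++⁺ʳ (base ψ (ρ ∘ ∈-++⁺ˡ))) allTrue)
    letter-truth (X ψ) ρ u complete allTrue = letter-truth ψ ρ u complete allTrue
    letter-truth (ψ U χ) ρ u complete allTrue = cong₂ _,_
      (letter-truth ψ (ρ ∘ ∈-++⁺ˡ) u (λ a → complete a ∘ ∈-++⁺ˡ) allTrue)
      (letter-truth χ (ρ ∘ ∈-++⁺ʳ (entriesᵖ ψ)) u (λ a → complete a ∘ ∈-++⁺ʳ (base ψ (ρ ∘ ∈-++⁺ˡ))) allTrue)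

    clauses-sound ψ ρ p P u x with c , c∈ , all ← ⟦disj⟧⁻ (clauses ψ ρ p P (label u)) x
      with o , C , refl , C∈ , px ← ∈-clauses⁻ ψ ρ p P (label u) c∈
      rewrite letter-truth ψ ρ u (λ a → choices-complete (base ψ ρ) C∈) (λ a a∈ → all a (⊆-clause p o a∈))
      with o
    ... | nothing = _ , px , 0 , refl
    ... | just v with f , _ , y ← all (own p v) (here refl) with e , d , r ← y Fin.zero =
      _ , px , suc d , _ , v , e , r , refl

    clauses-complete ψ ρ p P u d pv r with C , C∈ , all ← choices-realised (True-exhaustive u) (base ψ ρ)
      with eq ← letter-truth ψ ρ u (λ a → choices-complete (base ψ ρ) C∈) all with d
    -- The prefix ends at this node: exit, with `empty` as the valuation of the rest.
    ... | zero rewrite r = nothing , C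
      , ∈-clauses⁺ ψ ρ p P (label u) nothing C∈ (subst (λ l → P (step ψ l (empty ψ))) (sym eq) pv) , C∈ , all , tt
    ... | suc d with u′ , v′ , e , r′ , refl ← r = just v′ , C
      , ∈-clauses⁺ ψ ρ p P (label u) (just v′) C∈ (subst (λ l → P (step ψ l v′)) (sym eq) pv) , C∈ , all
      , (u′ , d , e , r′ , ℕ.≤-refl)

    δ⁺-sound : ∀ {e} (p : e ∈ L) s u → ⟦ δ⁺ p s (label u) ⟧ (True u) → ∃[ d ] Meaning⁺ e s u d
    δ⁺-sound {next φ}  p s u x = 0 , translate-sound φ (embed p) u x
    δ⁺-sound {along ψ} p v u x with _ , refl , r ← clauses-sound ψ (embed p) p (v ≡_) u x = r

    δ-universal : ∀ {e} (p : e ∈ L) s u → ¬ (∃[ d ] Meaning⁺ e s u d) → ⟦ δ (mk p s universal) (label u) ⟧ (True u)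
    δ-universal p s u ¬x with dualise-exhaustive dualAtom (True-exhaustive u) (δ⁺ p s (label u))
    ... | inj₁ x = ⊥-elim (¬x (δ⁺-sound p s u x))
    ... | inj₂ y = y

    open Ranking key height F using (Progress)

    Winning : Q → ℕ → Q → Pred Node 0ℓ
    Winning q d q′ v = ∃[ d′ ] (Meaning q′ v d′ × Progress q d q′ d′)

    lower-winning : ∀ q d u a → atomHeight a < height (key q) → True u a → AtomHolds (Winning q d) u a
    lower-winning q d u (m , q′) lower = AtomHolds-map m λ _ (d′ , x) → d′ , x , inj₁ lower

    winning : ∀ q u d → F q ⊎ kindOf (key q) ≡ transient →
      ⟦ δ q (label u) ⟧ (True u) → ⟦ δ q (label u) ⟧ (AtomHolds (Winning q d) u)
    winning q u d h = ⟦⟧-mono (δ q (label u)) (upgrade h)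
      where
      upgrade : F q ⊎ kindOf (key q) ≡ transient → ∀ a → a ∈ atoms (δ q (label u)) → True u a → AtomHolds (Winning q d) u a
      upgrade h (m , q′) a∈ x with δ-atoms q (label u) a∈ | h
      ... | inj₁ lower        | _         = lower-winning q d u (m , q′) lower x
      ... | inj₂ (eq , _ , _) | inj₁ f    = AtomHolds-map m (λ _ (d′ , y) → d′ , y , inj₂ (eq , inj₁ f)) x
      ... | inj₂ (_ , k , _)  | inj₂ k′   with () ← trans (sym k) k′

    move : ∀ q u d → Meaning q u d → ⟦ δ q (label u) ⟧ (AtomHolds (Winning q d) u)
    move q@(mk {next φ} p s existential) u d x = winning q u d (inj₂ refl) (translate-complete φ (embed p) u x)
    move q@(mk {next φ} p s universal) u d x = winning q u d (inj₂ refl) (δ-universal p s u x)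
    move q@(mk {along ψ} p v universal) u d x = winning q u d (inj₁ tt) (δ-universal p v u x)
    -- The one case that consumes rank: the witness path is shortened by an edge or the component is
    -- left.
    move q@(mk {along ψ} p v existential) u d r
      with clauses-complete ψ (embed p) p (v ≡_) u d refl r
    ... | o , C , c∈ , C∈ , all , res = ⟦disj⟧⁺ c∈ (good o res)
      where
      good : ∀ o → Resumes ψ o u d → ∀ a → a ∈ clause p (o , C) → AtomHolds (Winning q d) u a
      good o res a a∈ with ∈-clause⁻ p o a∈
      ... | inj₂ a∈C = lower-winning q d u a (choices-below ψ (embed p) (embed-below p) C∈ a∈C) (all a a∈C)
      good (just v′) (u′ , d′ , e , r′ , d′<d) _ _ | inj₁ (_ , refl , refl) =
        (λ _ → u′) , (λ { {Fin.zero} {Fin.zero} _ → refl }) , λ _ → e , d′ , r′ , inj₂ (refl , inj₂ d′<d)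

    F̄ : Pred Q 0ℓ
    F̄ = F ∘ dual

    Refuted : Q → Node → ℕ → Set
    Refuted = Meaning ∘ dual

    Refuting : Q → ℕ → Q → Pred Node 0ℓ
    Refuting q d q′ v = ∃[ d′ ] (Refuted q′ v d′ × Ranking.Progress key height F̄ q d q′ d′)

    key-dual-injective : ∀ q q′ → key (dual q) ≡ key (dual q′) → key q ≡ key q′
    key-dual-injective (mk p s existential) (mk _ _ existential) refl = refl
    key-dual-injective (mk p s universal)   (mk _ _ universal)   refl = refl

    progress-dual : ∀ q d q′ d′ → Progress (dual q) d (dual q′) d′ → Ranking.Progress key height F̄ q d q′ d′
    progress-dual q d q′ d′ (inj₁ lower) = inj₁ (subst (_ <_) (height-dual q) (subst (_< _) (height-dual q′) lower))
    progress-dual q d q′ d′ (inj₂ (eq , x)) = inj₂ (key-dual-injective q′ q eq , x)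

    -- The opponent at `q` plays the strategy of `dual q`, whose transition is the dual formula; it
    -- therefore meets the formula satisfied by the run in some atom.
    refute : ∀ q u d → Refuted q u d → ∀ (V : Pred (Atom Q) 0ℓ) → ⟦ δ q (label u) ⟧ V →
      ∃[ m ] ∃[ q′ ] (V (m , q′) × AtomHolds (Refuting q d) u (flip m , q′))
    refute q u d x V sat
      with (m , q′) , y , z ← dualise-disjoint dualAtom (δ q (label u)) sat
             (subst (λ θ → ⟦ θ ⟧ (AtomHolds (Winning (dual q) d) u)) (δ-dual q (label u)) (move (dual q) u d x)) =
      m , q′ , y , AtomHolds-map (flip m) (λ _ (d′ , w , p) → d′ , w , progress-dual q d q′ d′ p) z

    F-F̄-apart : ∀ {q q′} → F q → F̄ q′ → key q ≢ key q′
    F-F̄-apart {mk {along ψ} p s universal} {mk {along ψ′} p′ s′ existential} _ _ ()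

    accepts : ∀ q → Holds q root → Language (automaton q) t
    accepts q (d , x) = run , accepting
      where open Game.Unravel (automaton q) t key height F Meaning id move root d x

    rejects : ∀ q → Holds (dual q) root → ¬ Language (automaton q) t
    rejects q (d , x) (r , acc-r) = rejecting acc-r
      where open Game.Refute (automaton q) t key height F̄ Refuted (λ {q} {q′} → F-F̄-apart {q} {q′}) refute {d₀ = d} x r

    -- Reinitialised automata and complementary languages.

    module _ (q : Q) (m : Modality) (q₁ : Q) where
      open Reinitialised (automaton q) (atom (m , q₁)) using (δ^; F^)

      key^ : Maybe Q → Maybe Key
      key^ = Maybe.map key

      -- `length L` exceeds every level, so the move out of the fresh initial state counts as a
      -- descent.
      height^ : Maybe Key → ℕ
      height^ = maybe height (length L)

      accepts^ : True root (m , q₁) → Language (automaton q ^ atom (m , q₁)) t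
      accepts^ x = run , accepting
        where
        Meaning^ : Maybe Q → Node → ℕ → Set
        Meaning^ nothing  u d = True u (m , q₁)
        Meaning^ (just q) u d = Meaning q u d

        progress^ : ∀ {q d q′ d′} → Progress q d q′ d′ → Ranking.Progress key^ height^ F^ (just q) d (just q′) d′
        progress^ (inj₁ lower)    = inj₁ lower
        progress^ (inj₂ (eq , x)) = inj₂ (cong just eq , x)

        open Game (automaton q ^ atom (m , q₁)) t key^ height^ F^ Meaning^

        move^ : ∀ q u d → Meaning^ q u d → ⟦ δ^ q (label u) ⟧ (AtomHolds (WinsFrom q d) u)
        move^ nothing u d x = AtomHolds-map m (λ _ (d′ , y) → d′ , y , inj₁ (height-bounded q₁)) x
        move^ (just q) u d x = ⟦mapB⁺⟧⁺ _ (δ q (label u))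
          (⟦⟧-mono (δ q (label u)) (λ (m , q′) _ → AtomHolds-map m λ _ (d′ , y , p) → d′ , y , progress^ p) (move q u d x))

        open Unravel id move^ root 0 x

      rejects^ : True root (dualAtom (m , q₁)) → ¬ Language (automaton q ^ atom (m , q₁)) t
      rejects^ x (r , acc-r) = rejecting acc-r
        where
        Refuted^ : Maybe Q → Node → ℕ → Set
        Refuted^ nothing  u d = True u (dualAtom (m , q₁))
        Refuted^ (just q) u d = Refuted q u d

        F̄^ : Pred (Maybe Q) 0ℓ
        F̄^ = maybe F̄ ⊥

        progress^ : ∀ {q d q′ d′} → Ranking.Progress key height F̄ q d q′ d′ →
          Ranking.Progress key^ height^ F̄^ (just q) d (just q′) d′
        progress^ (inj₁ lower)    = inj₁ lower
        progress^ (inj₂ (eq , x)) = inj₂ (cong just eq , x)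

        apart^ : ∀ {q q′} → F^ q → F̄^ q′ → key^ q ≢ key^ q′
        apart^ {just q} {just q′} f f̄ eq = F-F̄-apart {q} {q′} f f̄ (just-injective eq)

        open Game (automaton q ^ atom (m , q₁)) t key^ height^ F̄^ Refuted^

        refute^ : ∀ q u d → Refuted^ q u d → ∀ (V : Pred (Atom (Maybe Q)) 0ℓ) → ⟦ δ^ q (label u) ⟧ V →
          ∃[ m ] ∃[ q′ ] (V (m , q′) × AtomHolds (WinsFrom q d) u (flip m , q′))
        refute^ nothing u d x V sat =
          m , just q₁ , sat , AtomHolds-map (flip m) (λ _ (d′ , y) → d′ , y , inj₁ (height-bounded q₁)) x
        refute^ (just q) u d x V sat
          with m , q′ , y , z ← refute q u d x _ (⟦mapB⁺⟧⁻ _ (δ q (label u)) sat) =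
          m , just q′ , y , AtomHolds-map (flip m) (λ _ (d′ , w , p) → d′ , w , progress^ p) z

        open Refute (λ {q} {q′} → apart^ {q} {q′}) refute^ {d₀ = 0} x r

  -- Determinacy: at the root the atom or its dual is true, and either case decides both languages.
  complementary : ∀ q m q₁ → Language (automaton q ^ atom (m , q₁)) ≐ ∁ (Language (automaton q ^ atom (dualAtom (m , q₁))))
  complementary q m q₁ = (λ {t} → disjoint t) , (λ {t} → exhaustive t)
    where
    disjoint : ∀ t → Language (automaton q ^ atom (m , q₁)) t → ¬ Language (automaton q ^ atom (dualAtom (m , q₁))) t
    disjoint t r r′ with Semantics.True-exhaustive t (Tree.root t) (m , q₁)
    ... | inj₂ x = Semantics.rejects^ t q m q₁ x r
    ... | inj₁ x = Semantics.rejects^ t q (flip m) (dual q₁)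
      (subst (Semantics.True t (Tree.root t)) (sym (dualAtom-involutive (m , q₁))) x) r′

    exhaustive : ∀ t → ¬ Language (automaton q ^ atom (dualAtom (m , q₁))) t → Language (automaton q ^ atom (m , q₁)) t
    exhaustive t ¬r′ with Semantics.True-exhaustive t (Tree.root t) (m , q₁)
    ... | inj₁ x = Semantics.accepts^ t q m q₁ x
    ... | inj₂ x = ⊥-elim (¬r′ (Semantics.accepts^ t q (flip m) (dual q₁) x))

  -- Components and the hesitant structure.

  size : ℕ
  size = length L ℕ.* 2

  code : Polarity → Fin 2
  code existential = zero
  code universal   = suc zero

  decode : Fin 2 → Polarity
  decode zero    = existential
  decode (suc _) = universal

  decode-code : ∀ b → decode (code b) ≡ b
  decode-code existential = refl
  decode-code universal   = refl

  code-decode : ∀ c → code (decode c) ≡ c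
  code-decode zero       = refl
  code-decode (suc zero) = refl

  -- The level is the leading digit. The two polarities of an entry share a level, and no transition
  -- links them, so their mutual order is arbitrary.
  indexOf : Key → Fin size
  indexOf ((_ , p) , b) = Fin.combine (level p) (code b)

  keyAt : Fin size → Key
  keyAt i = Product.map (position L) decode (Fin.remQuot 2 i)

  keyAt-indexOf : ∀ k → keyAt (indexOf k) ≡ k
  keyAt-indexOf ((e , p) , b) = trans
    (cong (Product.map (position L) decode) (Fin.remQuot-combine (level p) (code b)))
    (cong₂ _,_ (position-level p) (decode-code b))

  indexOf-keyAt : ∀ i → indexOf (keyAt i) ≡ i
  indexOf-keyAt i = trans
    (cong₂ Fin.combine (level-position L (proj₁ (Fin.remQuot {length L} 2 i)))
               (code-decode (proj₂ (Fin.remQuot {length L} 2 i))))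
    (Fin.combine-remQuot {length L} 2 i)

  indexOf-mono : ∀ k k′ → height k′ < height k → indexOf k′ Fin.< indexOf k
  indexOf-mono ((_ , p) , b) ((_ , p′) , b′) lower = Fin.combine-monoˡ-< {i = level p′} {level p} (code b′) (code b) lower

  comp : Q → Fin size
  comp = indexOf ∘ key

  comp-keyAt : ∀ {q i} → comp q ≡ i → key q ≡ keyAt i
  comp-keyAt {q} refl = sym (keyAt-indexOf (key q))

  comp-injective : ∀ {q q′} → comp q ≡ comp q′ → key q ≡ key q′
  comp-injective {q} {q′} eq = trans (comp-keyAt {q} eq) (keyAt-indexOf (key q′))

  lower-apart : ∀ {q q′} → height (key q′) < height (key q) → comp q′ ≢ comp q
  lower-apart {q} {q′} lower eq = ℕ.<⇒≢ lower (cong height (comp-injective {q′} {q} eq))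

  kind : Fin size → Kind
  kind = kindOf ∘ keyAt

  kind-comp : ∀ q → kind (comp q) ≡ kindOf (key q)
  kind-comp q = cong kindOf (keyAt-indexOf (key q))

  nontransient-key : ∀ k {b} → kindOf k ≡ nontransient b → ∃[ ψ ] Σ[ p ∈ along ψ ∈ L ] k ≡ ((along ψ , p) , b)
  nontransient-key ((along ψ , p) , b) refl = ψ , p , refl

  state-at : ∀ {ψ} {p : along ψ ∈ L} {b} q → key q ≡ ((along ψ , p) , b) → ∃[ v ] q ≡ mk p v b
  state-at (mk p v b) refl = v , refl

  -- Lets one argument serve both polarities: CNF clauses of the universal copy are the images under
  -- `dualAtom` of DNF clauses of the existential copy.
  polarise : Polarity → Atom Q → Atom Q
  polarise existential = id
  polarise universal   = dualAtom

  polarise-involutive : ∀ b a → polarise b (polarise b a) ≡ a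
  polarise-involutive existential a = refl
  polarise-involutive universal   a = dualAtom-involutive a

  polarise-dual : ∀ b a → polarise b (dualAtom a) ≡ dualAtom (polarise b a)
  polarise-dual existential a = refl
  polarise-dual universal   a = refl

  polarise-height : ∀ b a → atomHeight (polarise b a) ≡ atomHeight a
  polarise-height existential a       = refl
  polarise-height universal   (m , q) = height-dual q

  polarise-own : ∀ {ψ} b (p : along ψ ∈ L) v → polarise b (own p v) ≡ (ownModality b , mk p v b)
  polarise-own existential p v = refl
  polarise-own universal   p v = refl

  normalForm⁻ : ∀ {ψ} (p : along ψ ∈ L) v b σ {c} → c ∈ normalForm b (δ (mk p v b) σ) →
    ∃[ o ] ∃[ C ] (c ≡ map (polarise b) (clause p (o , C)) × C ∈ choices (base ψ (embed p)) ×
                   v ≡ step ψ (letter ψ (embed p) σ (_∈ C)) (resume ψ o))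
  normalForm⁻ {ψ} p v existential σ c∈
    with o , C , refl , rest ← ∈-clauses⁻ ψ (embed p) p (v ≡_) σ
           (subst (_ ∈_) (dnf-disj (clauses ψ (embed p) p (v ≡_) σ)) c∈) =
    o , C , sym (map-id _) , rest
  normalForm⁻ {ψ} p v universal σ c∈
    with c′ , c′∈ , refl ← ∈-map⁻ (map dualAtom) (subst (_ ∈_)
           (trans (cnf-dualise dualAtom (disj (clauses ψ (embed p) p (v ≡_) σ)))
                  (cong (map (map dualAtom)) (dnf-disj (clauses ψ (embed p) p (v ≡_) σ)))) c∈)
    with o , C , refl , rest ← ∈-clauses⁻ ψ (embed p) p (v ≡_) σ c′∈ =
    o , C , refl , rest

  choice-lower : ∀ {ψ} (p : along ψ ∈ L) b {C a} → C ∈ choices (base ψ (embed p)) → a ∈ C →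
    atomHeight (polarise b a) < Fin.toℕ (level p)
  choice-lower {ψ} p b {a = a} C∈ a∈ =
    subst (_< _) (sym (polarise-height b a)) (choices-below ψ (embed p) (embed-below p) C∈ a∈)

  -- Annotation atoms sit on strictly lower levels, so an atom inside the component can only be the
  -- own atom of the clause.
  clause-own : ∀ {ψ} (p : along ψ ∈ L) b o {C a} → C ∈ choices (base ψ (embed p)) →
    a ∈ map (polarise b) (clause p (o , C)) → key (proj₂ a) ≡ ((along ψ , p) , b) →
    ∃[ v ] (o ≡ just v × a ≡ (ownModality b , mk p v b))
  clause-own p b o C∈ a∈ eq with a₀ , a₀∈ , refl ← ∈-map⁻ (polarise b) a∈ with ∈-clause⁻ p o a₀∈
  ... | inj₁ (v , o≡ , refl) = v , o≡ , polarise-own b p v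
  ... | inj₂ a₀∈C = ⊥-elim (ℕ.<⇒≢ (choice-lower p b C∈ a₀∈C) (cong height eq))

  letter-cong : ∀ ψ (ρ : entriesᵖ ψ List.⊆ L) σ {C C′ : Pred (Atom Q) 0ℓ} → C ⊆ C′ → C′ ⊆ C →
    letter ψ ρ σ C ≡ letter ψ ρ σ C′
  letter-cong (state φ) ρ σ to from =
    Dec.does-⇔ (mk⇔ (⟦⟧-mono (translate φ ρ σ) (λ _ _ → to)) (⟦⟧-mono (translate φ ρ σ) (λ _ _ → from))) (lem _) (lem _)
  letter-cong (ψ and χ) ρ σ to from =
    cong₂ _,_ (letter-cong ψ (ρ ∘ ∈-++⁺ˡ) σ to from) (letter-cong χ (ρ ∘ ∈-++⁺ʳ (entriesᵖ ψ)) σ to from)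
  letter-cong (ψ or χ) ρ σ to from =
    cong₂ _,_ (letter-cong ψ (ρ ∘ ∈-++⁺ˡ) σ to from) (letter-cong χ (ρ ∘ ∈-++⁺ʳ (entriesᵖ ψ)) σ to from)
  letter-cong (X ψ) ρ σ to from = letter-cong ψ ρ σ to from
  letter-cong (ψ U χ) ρ σ to from =
    cong₂ _,_ (letter-cong ψ (ρ ∘ ∈-++⁺ˡ) σ to from) (letter-cong χ (ρ ∘ ∈-++⁺ʳ (entriesᵖ ψ)) σ to from)

  at-most-one : ∀ q σ b → kind (comp q) ≡ nontransient b → ∀ c → c ∈ normalForm b (δ q σ) → ∀ a a′ → a ∈ c → a′ ∈ c →
    comp (proj₂ a) ≡ comp q → comp (proj₂ a′) ≡ comp q → a ≡ a′
  at-most-one q σ b k c c∈ a a′ a∈ a′∈ ≡q ≡q′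
    with ψ , p , key≡ ← nontransient-key (key q) (trans (sym (kind-comp q)) k)
    with v , refl ← state-at q key≡
    with o , C , refl , C∈ , _ ← normalForm⁻ p v b σ c∈
    with v₁ , refl , refl ← clause-own p b o C∈ a∈ (comp-injective {proj₂ a} {q} ≡q)
    with _ , refl , refl ← clause-own p b o C∈ a′∈ (comp-injective {proj₂ a′} {q} ≡q′) = refl

  hta : Q → HTA± n
  hta q₀ = record
    { automaton = automaton q₀
    ; size = size
    ; comp = comp
    ; nonempty = λ i → inhabitant i , trans (cong indexOf (inhabitant-key (keyAt i))) (indexOf-keyAt i)
    ; kind = kind
    ; descending = descending
    ; transient-exits = transient-exits
    ; own-modality = own-modality
    ; at-most-one = at-most-one
    ; existential-rejecting = λ q k → rejecting q (trans (sym (kind-comp q)) k)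
    ; universal-accepting = λ q k → accepting q (trans (sym (kind-comp q)) k)
    }
    where
    default : ∀ e → St e
    default (next φ)  = tt
    default (along ψ) = empty ψ

    inhabitant : Fin size → Q
    inhabitant i = let (e , p) , b = keyAt i in mk p (default e) b

    inhabitant-key : ∀ (k : Key) → key (let (e , p) , b = k in mk p (default e) b) ≡ k
    inhabitant-key ((e , p) , b) = refl

    descending : ∀ q σ m q′ → (m , q′) ∈ atoms (δ q σ) → comp q′ Fin.≤ comp q
    descending q σ m q′ a∈ with δ-atoms q σ a∈
    ... | inj₁ lower        = ℕ.<⇒≤ (indexOf-mono (key q) (key q′) lower)
    ... | inj₂ (eq , _ , _) = Fin.≤-reflexive (cong indexOf eq)

    transient-exits : ∀ q σ m q′ → kind (comp q) ≡ transient → (m , q′) ∈ atoms (δ q σ) → comp q′ ≢ comp q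
    transient-exits q σ m q′ k a∈ with δ-atoms q σ a∈
    ... | inj₁ lower         = lower-apart {q} {q′} lower
    ... | inj₂ (_ , k′ , _) with () ← trans (sym k′) (trans (sym (kind-comp q)) k)

    own-modality : ∀ q σ m q′ b → kind (comp q) ≡ nontransient b → (m , q′) ∈ atoms (δ q σ) →
      comp q′ ≡ comp q → m ≡ ownModality b
    own-modality q σ m q′ b k a∈ eq with δ-atoms q σ a∈
    ... | inj₁ lower          = ⊥-elim (lower-apart {q} {q′} lower eq)
    ... | inj₂ (_ , k′ , m≡) with refl ← trans (sym k′) (trans (sym (kind-comp q)) k) = m≡

    rejecting : ∀ q → kindOf (key q) ≡ nontransient existential → ¬ F q
    rejecting (mk {along ψ} p v existential) _ ()

    accepting : ∀ q → kindOf (key q) ≡ nontransient universal → F q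
    accepting (mk {along ψ} p v universal) _ = tt

  -- Linearisations: counter-freeness and visibility.

  module Linearised (q₀ : Q) {ψ : PathFormula n} (p : along ψ ∈ L) (b : Polarity)
                    (i : Fin size) (key≡ : keyAt i ≡ ((along ψ , p) , b)) where

    Comp : Set
    Comp = Component (hta q₀) i

    Ann : Set₁
    Ann = Annotation (hta q₀) i

    in-component : ∀ {q} → comp q ≡ i → key q ≡ ((along ψ , p) , b)
    in-component {q} eq = trans (comp-keyAt {q} eq) key≡

    valOf : Comp → Val ψ
    valOf (q , eq) = proj₁ (state-at q (in-component eq))

    state≡ : ∀ (c : Comp) → proj₁ c ≡ mk p (valOf c) b
    state≡ (q , eq) = proj₂ (state-at q (in-component eq))

    valOf-injective : ∀ {c c′ : Comp} → valOf c ≡ valOf c′ → c ≡ c′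
    valOf-injective {c} {c′} eq = same-state (trans (state≡ c) (trans (cong (λ v → mk p v b) eq) (sym (state≡ c′))))
      where
      same-state : ∀ {c c′ : Comp} → proj₁ c ≡ proj₁ c′ → c ≡ c′
      same-state {_ , refl} {_ , refl} refl = refl

    polarised : Ann → Pred (Atom Q) 0ℓ
    polarised C a = asAtoms (hta q₀) C (polarise b a)

    letterOf : Subset n × Ann → Letter ψ
    letterOf (σ , C) = letter ψ (embed p) σ (polarised C)

    -- The hypotheses say that clause and annotation agree up to atoms of the component. Dropping
    -- the own atom and undoing the polarity recovers the choice that was made.
    annotation≐choice : ∀ {C : Ann} {C₀ o} → C₀ ∈ choices (base ψ (embed p)) →
      (∀ {a} → a ∈ map (polarise b) (clause p (o , C₀)) → comp (proj₂ a) ≡ i ⊎ asAtoms (hta q₀) C a) →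
      (∀ {a} → asAtoms (hta q₀) C a → a ∈ map (polarise b) (clause p (o , C₀))) →
      (_∈ C₀) ≐ polarised C
    annotation≐choice {C} {C₀} {o} C₀∈ only all = (λ {a} → to a) , (λ {a} → from a)
      where
      to : ∀ a → a ∈ C₀ → polarised C a
      to a a∈ with only (∈-map⁺ (polarise b) (⊆-clause p o a∈))
      ... | inj₁ eq = ⊥-elim (ℕ.<⇒≢ (choice-lower p b C₀∈ a∈) (cong height (in-component {proj₂ (polarise b a)} eq)))
      ... | inj₂ x  = x

      from : ∀ a → polarised C a → a ∈ C₀
      from a (out , x) with a′ , a′∈ , eq ← ∈-map⁻ (polarise b) (all (out , x)) with ∈-clause⁻ p o a′∈
      ... | inj₂ a′∈C₀ = subst (_∈ C₀) (trans (sym (polarise-involutive b a′))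
              (trans (cong (polarise b) (sym eq)) (polarise-involutive b a))) a′∈C₀
      ... | inj₁ (v , _ , refl) = ⊥-elim (out (trans
              (cong (comp ∘ proj₂) (trans eq (polarise-own b p v))) (trans (cong indexOf (sym key≡)) (indexOf-keyAt i))))

    open WordAutomaton

    Linear : Comp → WordAutomaton
    Linear = linearisation (hta q₀) i b

    module _ (c₀ : Comp) where

      transition-choice : ∀ {c σ C s} → Transition (Linear c₀) (just c) (σ , C) s →
        ∃[ o ] ∃[ C₀ ] (C₀ ∈ choices (base ψ (embed p)) × (_∈ C₀) ≐ polarised C ×
          valOf c ≡ step ψ (letter ψ (embed p) σ (_∈ C₀)) (resume ψ o) ×
          (∀ c′ → s ≡ just c′ → o ≡ just (valOf c′)))
      transition-choice {c} {σ} {C} {nothing} (cl , cl∈ , to , from)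
        with o , C₀ , refl , C₀∈ , eq ← normalForm⁻ p (valOf c) b σ
               (subst (λ q → cl ∈ normalForm b (δ q σ)) (state≡ c) cl∈) =
        o , C₀ , C₀∈ , annotation≐choice {C} {o = o} C₀∈ (inj₂ ∘ to) from , eq , λ _ ()
      transition-choice {c} {σ} {C} {just c′} (cl , cl∈ , to , from)
        with o , C₀ , refl , C₀∈ , eq ← normalForm⁻ p (valOf c) b σ
               (subst (λ q → cl ∈ normalForm b (δ q σ)) (state≡ c) cl∈) =
        o , C₀ , C₀∈ , annotation≐choice {C} {o = o} C₀∈ (λ a∈ → Sum.map₁ (λ { refl → proj₂ c′ }) (to a∈)) (from ∘ inj₂) , eq
        , λ { _ refl → target }
        where
        target : o ≡ just (valOf c′)
        target with v , o≡ , eq′ ← clause-own p b o C₀∈ (from (inj₁ refl)) (in-component {proj₁ c′} (proj₂ c′))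
          with refl ← trans (sym (state≡ c′)) (cong proj₂ eq′) = o≡

      transition-step : ∀ {c a c′} → Transition (Linear c₀) (just c) a (just c′) → valOf c ≡ step ψ (letterOf a) (valOf c′)
      transition-step {c} {σ , C} {c′} tr
        with o , C₀ , _ , (to , from) , eq , target ← transition-choice {c} {σ} {C} {just c′} tr
        with refl ← target c′ refl =
        trans eq (cong (λ l → step ψ l (valOf c′)) (letter-cong ψ (embed p) σ to from))

      exit-absorbing : ∀ {w c} → ¬ Path (Linear c₀) nothing w (just c)
      exit-absorbing (_∷_ {p′ = nothing} _ π) = exit-absorbing π

      path-steps : ∀ {c w c′} → Path (Linear c₀) (just c) w (just c′) → valOf c ≡ steps ψ (map letterOf w) (valOf c′)
      path-steps [] = refl
      path-steps (_∷_ {p′ = nothing} _ π) = ⊥-elim (exit-absorbing π)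
      path-steps {c} (_∷_ {a = a} {p′ = just c″} tr π) =
        trans (transition-step {c} {a} {c″} tr) (cong (step ψ (letterOf a)) (path-steps π))

      path-split : ∀ u {w s s′} → Path (Linear c₀) s (u ++ w) s′ →
        ∃[ m ] (Path (Linear c₀) s u m × Path (Linear c₀) m w s′)
      path-split []      π = _ , [] , π
      path-split (a ∷ u) (tr ∷ π) with m , π₁ , π₂ ← path-split u π = m , tr ∷ π₁ , π₂

      exit-loop : ∀ u → Path (Linear c₀) nothing u nothing
      exit-loop []      = []
      exit-loop (a ∷ u) = tt ∷ exit-loop u

      power-steps : ∀ k u v → steps ψ (map letterOf (concat (replicate k u))) v ≡ iter k (steps ψ (map letterOf u)) v
      power-steps k u v = trans
        (cong (λ w → steps ψ w v) (trans (sym (concat-map (replicate k u)))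
          (cong concat (map-replicate (map letterOf) k u))))
        (steps-power ψ k (map letterOf u) v)

      counter-free : CounterFreeWA (Linear c₀)
      counter-free nothing  u k _ _ = exit-loop u
      counter-free (just c) u (suc k) _ π with path-split u π
      ... | nothing , _ , π₂  = ⊥-elim (exit-absorbing π₂)
      -- The first block ends in `c′`. By aperiodicity one block fixes the valuation of `c`; the
      -- other k blocks lead from `c′` to `c`, so `c′` has that valuation too, and the first block
      -- is the required loop.
      ... | just c′ , π₁ , π₂ = subst (λ c′ → Path (Linear c₀) (just c) u (just c′)) (valOf-injective back) π₁
        where
        fixed : steps ψ (map letterOf u) (valOf c) ≡ valOf c
        fixed = steps-aperiodic ψ (map letterOf u) k (valOf c)
          (trans (sym (power-steps (suc k) u (valOf c))) (sym (path-steps π)))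

        back : valOf c′ ≡ valOf c
        back = trans (path-steps π₂) (trans (power-steps k u (valOf c)) (iter-fixed fixed k))

    -- Both annotations are choices over one base list: they coincide, or an atom of one has its
    -- dual in the other.
    visible : VisibleComponent (hta q₀) i b
    visible c₀ C C′ (c , σ , s , tr) (c′ , σ′ , s′ , tr′) C≢C′
      with _ , C₀ , C₀∈ , (to , from) , _ ← transition-choice c₀ {c} {σ} {C} {s} tr
         | _ , C₀′ , C₀′∈ , (to′ , from′) , _ ← transition-choice c₀ {c′} {σ′} {C′} {s′} tr′
      with choices-differ (base ψ (embed p)) C₀∈ C₀′∈
    ... | inj₂ (a , a∈ , a′∈) with to a∈ | to′ a′∈
    ...   | out , x | out′ , x′ = (polarise b a , out) , (polarise b (dualAtom a) , out′) , x , x′ ,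
              subst (Complementary (hta q₀) (polarise b a)) (sym (polarise-dual b a))
                (complementary q₀ (proj₁ (polarise b a)) (proj₂ (polarise b a)))
    visible c₀ C C′ (c , σ , s , tr) (c′ , σ′ , s′ , tr′) C≢C′ | inj₁ refl =
      ⊥-elim (C≢C′ ( (λ {(a , out)} x → transfer {C} {C′} from to′ a out x)
                   , (λ {(a , out)} x → transfer {C′} {C} from′ to a out x)))
      where
      transfer : ∀ {C C′ : Ann} → polarised C ⊆ (_∈ C₀) → (_∈ C₀) ⊆ polarised C′ → ∀ a out → C (a , out) → C′ (a , out)
      transfer {C} {C′} from to a out x = proj₂ (subst (asAtoms (hta q₀) C′) (polarise-involutive b a)
        (to (from (subst (asAtoms (hta q₀) C) (sym (polarise-involutive b a)) (out , x)))))

  hta-counter-free : ∀ q₀ → CounterFree (hta q₀)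
  hta-counter-free q₀ i b k with ψ , p , key≡ ← nontransient-key (keyAt i) k = Linearised.counter-free q₀ p b i key≡

  hta-visible : ∀ q₀ → Visible (hta q₀)
  hta-visible q₀ i b k with ψ , p , key≡ ← nontransient-key (keyAt i) k = Linearised.visible q₀ p b i key≡

theorem7p5 : ExcludedMiddle (lsuc 0ℓ) →
    ∀ (n : ℕ) (φ : StateFormula n) →
    Σ[ 𝒜 ∈ HTA± n ] CounterFree 𝒜 × Visible 𝒜 × ModelsOf φ ≐ Language (HTA±.automaton 𝒜)
theorem7p5 em n φ = hta q₀ , hta-counter-free q₀ , hta-visible q₀
  , (λ {t} sat → Semantics.accepts t q₀ (0 , sat))
  , (λ {t} r → by-contradiction λ ¬sat → Semantics.rejects t q₀ (0 , ¬sat ∘ proj₂) r)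
  where
  open Classical em
  -- The extra head entry supplies the initial state: it reads φ at the root and lies above every
  -- entry of φ.
  open Construction em (next φ ∷ entriesˢ φ) (id ∷ closedˢ φ)

  q₀ : Q
  q₀ = mk (here refl) tt existential
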